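{- Let $\alpha=(\alpha_1,\dots,\alpha_s)$ be a composition with $\alpha_1,\alpha_s\ge 2$, and let $F=\breve F(\alpha)$ be the corresponding fence. Then the following hold for rowmotion on $F$ (statistics $\chi$ refer to rowmotion orbits on antichains, statistics $\hat\chi$ refer to rowmotion orbits on ideals). (a) If $x,y\in\breve S_i$ for some $i$, then $\chi_x-\chi_y$ is $0$-mesic. (b) If $x\in\breve S_i$, $y=s_i$ and $z=s_{i-1}$, then $\alpha_i\chi_x+\chi_y+\chi_z$ is $1$-mesic (where $\chi_{s_0}$ and $\chi_{s_s}$ are interpreted as $0$). (c) If $x=s_{1,j}$ and $y=s_{1,k}$, then $k\hat\chi_x-j\hat\chi_y$ is $(k-j)$-mesic. (d) Let $x=s_{2i-1}$ and $y=s_{2j}$. If $r_{2i-1}(\mathcal O)=r_{2j}(\mathcal O)$ for all orbits $\mathcal O$, then $\hat\chi_x+\hat\chi_y$ is $1$-mesic. (e) If $s$ is odd and all the $\alpha_i$ are even, then $\#\mathcal O$ is even for all orbits $\mathcal O$. (f) If $\alpha_i=2$ for all $i\in[s]$, then $\chi$ is $s/2$-mesic.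
   Context: Fences. For a composition $\alpha=(\alpha_1,\dots,\alpha_s)$ (a finite sequence of positive integers) with $\alpha_1,\alpha_s\ge2$, put $p_0=0$, $p_i=\alpha_1+\dots+\alpha_i$ and $n=p_s-1$. The fence $\breve F(\alpha)$ is the poset on $\{x_1,\dots,x_n\}$ with covering relations, for $1\le k<n$ and $i$ such that $p_{i-1}\le k<p_i$: $x_k\lhd x_{k+1}$ if $i$ is odd, and $x_k\rhd x_{k+1}$ if $i$ is even. Thus $x_1\lhd\cdots\lhd x_{p_1}\rhd\cdots\rhd x_{p_2}\lhd\cdots$. The $i$th segment $S_i$ is the chain consisting of the $x_k$ with $p_{i-1}\le k\le p_i$, $1\le k\le n$. For $1\le i\le s-1$, $s_i=x_{p_i}$ is the unique (shared) element of $S_i\cap S_{i+1}$ (maximal in the fence if $i$ is odd, minimal if $i$ is even). $\breve S_i$ is the set of the $\alpha_i-1$ unshared elements of $S_i$ (those lying in no other segment), and $s_{i,j}$, $1\le j\le\alpha_i-1$, is the $j$th smallest element of $\breve S_i$ in the poset order. Rowmotion. For a finite poset $P$, $\mathcal A(P)$ and $\mathcal I(P)$ denote its sets of antichains and (lower order) ideals. Rowmotion on antichains is the bijection $\rho:\mathcal A(P)\to\mathcal A(P)$ sending $A$ to the set of minimal elements of $P\setminus I$, where $I$ is the ideal generated by $A$. Rowmotion on ideals is the bijection $\hat\rho:\mathcal I(P)\to\mathcal I(P)$ sending $I$ to the ideal generated by the minimal elements of $P\setminus I$. Orbits are orbits of the cyclic groups generated by these maps; $A\mapsto$ (ideal generated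 by $A$) gives a size-preserving bijection between orbits of $\rho$ and of $\hat\rho$, and both orbits are denoted $\mathcal O$. Statistics. $\chi_x(A)=1$ if $x\in A$ and $0$ otherwise; $\chi(A)=\#A$; $\hat\chi_x(I)=1$ if $x\in I$ and $0$ otherwise. For a statistic $\mathrm{st}$ (real-valued function), $\mathrm{st}(\mathcal O)=\sum_{y\in\mathcal O}\mathrm{st}(y)$. A statistic is $d$-mesic if $\mathrm{st}(\mathcal O)/\#\mathcal O=d$ for every orbit $\mathcal O$. For an orbit $\mathcal O$ of antichains and $1\le i\le s-1$, $r_i(\mathcal O)$ is the number of antichains in $\mathcal O$ containing $s_i$ (the number of red tiles with top square in row $i$ in the tiling picturing $\mathcal O$). -}

module Defs where

open import Data.Bool.Base using (if_then_else_)
open import Data.Empty using (⊥-elim)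
open import Data.Fin.Base using (Fin; toℕ; fromℕ<)
open import Data.Fin.Properties
  using (toℕ<n; toℕ-fromℕ<; toℕ-injective; all?; any?) renaming (_≟_ to _≟ᶠ_)
open import Data.Fin.Subset using (Subset; inside; _∈_; ∁; ∣_∣)
open import Data.Fin.Subset.Properties using (_∈?_)
open import Data.Integer.Base as ℤ using (ℤ; 0ℤ; 1ℤ; +_)
open import Data.List.Base as List using (List; []; _∷_; length; filter; allFin)
open import Data.List.Membership.Propositional using () renaming (_∈_ to _∈ˡ_)
open import Data.List.Relation.Unary.Any using (here; there)
open import Data.List.Relation.Unary.Unique.Propositional using (Unique)
open import Data.Nat.Base
open import Data.Nat.Divisibility using (_∣_; _∣?_)
open import Data.Nat.ListAction using (sum)
open import Data.Nat.Properties
open import Data.Product.Base using (∃; _×_; _,_; proj₁; proj₂)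
open import Data.Rational.Base as ℚ using (ℚ)
open import Data.Sum.Base using (_⊎_; inj₁; inj₂)
open import Data.Vec.Base using (Vec; lookup; tabulate; toList)
open import Data.Vec.Properties using (lookup∘tabulate; lookup⇒[]=; []=⇒lookup)
open import Function.Base using (_∘_)
open import Function.Bundles using (_⇔_; module Equivalence)
open import Level using (0ℓ)
open import Relation.Binary.Construct.Closure.Equivalence using (EqClosure)
open import Relation.Binary.Construct.Closure.ReflexiveTransitive using (Star; ε; _◅_; _◅◅_)
open import Relation.Binary.Core using (Rel)
open import Relation.Binary.Definitions using (tri<; tri≈; tri>) renaming (Decidable to Decidable₂)
open import Relation.Binary.PropositionalEquality
open import Relation.Binary.Structures using (IsDecPartialOrder)
open import Relation.Nullary using (Dec; yes; no; does; ¬_; contradiction)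
open import Relation.Nullary.Decidable using (map′; _×-dec_; _⊎-dec_; _→-dec_; ¬?; dec-true)
open import Relation.Unary using (Pred; Decidable)

------------------------------------------------------------------------
-- Orbits and homomesy

-- For a bijection f the equivalence closure of its graph relates exactly
-- the points lying in the same orbit of the cyclic group generated by f.

record Orbit {X : Set} (f : X → X) : Set where
  field
    elements : List X
    unique   : Unique elements
    base     : X
    spec     : ∀ y → y ∈ˡ elements ⇔ EqClosure (λ a b → f a ≡ b) base y

open Orbit public using (elements)

module _ {X : Set} {f : X → X} where

  #_ : Orbit f → ℕ
  # O = length (elements O)

  #-nonZero : (O : Orbit f) → NonZero (# O)
  #-nonZero O = go (Equivalence.from (Orbit.spec O (Orbit.base O)) ε)
    where
    go : ∀ {x : X} {xs} → x ∈ˡ xs → NonZero (length xs)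
    go (here _)  = _
    go (there _) = _

  total : (X → ℤ) → Orbit f → ℤ
  total st O = List.foldr ℤ._+_ 0ℤ (List.map st (elements O))

  average : (X → ℤ) → Orbit f → ℚ
  average st O = ℚ._/_ (total st O) (# O) {{#-nonZero O}}

-- Every statistic considered here is integer-valued; averages are rational.

Mesic : {X : Set} (f : X → X) → (X → ℤ) → ℚ → Set
Mesic f st d = (O : Orbit f) → average st O ≡ d

------------------------------------------------------------------------
-- Rowmotion

comprehension : ∀ {n} {P : Pred (Fin n) 0ℓ} → Decidable P → Subset n
comprehension P? = tabulate (does ∘ P?)

module _ {n} {P : Pred (Fin n) 0ℓ} (P? : Decidable P) where

  ∈-comprehension⁺ : ∀ {x} → P x → x ∈ comprehension P?
  ∈-comprehension⁺ {x} px =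
    lookup⇒[]= x _ (trans (lookup∘tabulate _ x) (dec-true (P? x) px))

  ∈-comprehension⁻ : ∀ {x} → x ∈ comprehension P? → P x
  ∈-comprehension⁻ {x} x∈
    with P? x | trans (sym (lookup∘tabulate (does ∘ P?) x)) ([]=⇒lookup x∈)
  ... | yes px | _  = px
  ... | no  _  | ()

module Rowmotion {n : ℕ} {_≤ᴾ_ : Rel (Fin n) 0ℓ}
                 (isDecPartialOrder : IsDecPartialOrder _≡_ _≤ᴾ_) where

  private module P = IsDecPartialOrder isDecPartialOrder

  IsAntichain : Subset n → Set
  IsAntichain A = ∀ {x y} → x ∈ A → y ∈ A → x ≤ᴾ y → x ≡ y

  IsIdeal : Subset n → Set
  IsIdeal I = ∀ {x y} → x ≤ᴾ y → y ∈ I → x ∈ I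

  -- The proof fields are irrelevant, so equality of antichains (of ideals)
  -- is equality of the underlying subsets.

  record Antichain : Set where
    constructor mkAntichain
    field
      set          : Subset n
      .isAntichain : IsAntichain set

  record Ideal : Set where
    constructor mkIdeal
    field
      set      : Subset n
      .isIdeal : IsIdeal set

  InGenerated : Subset n → Pred (Fin n) 0ℓ
  InGenerated A x = ∃ λ a → a ∈ A × x ≤ᴾ a

  inGenerated? : ∀ A → Decidable (InGenerated A)
  inGenerated? A x = any? λ a → (a ∈? A) ×-dec (x P.≤? a)

  Minimal : Subset n → Pred (Fin n) 0ℓ
  Minimal U x = x ∈ U × (∀ y → y ∈ U → y ≤ᴾ x → y ≡ x)

  minimal? : ∀ U → Decidable (Minimal U)
  minimal? U x =
    (x ∈? U) ×-dec all? λ y → (y ∈? U) →-dec ((y P.≤? x) →-dec (y ≟ᶠ x))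

  generated : Subset n → Subset n
  generated A = comprehension (inGenerated? A)

  minimals : Subset n → Subset n
  minimals U = comprehension (minimal? U)

  generated-isIdeal : ∀ A → IsIdeal (generated A)
  generated-isIdeal A x≤y y∈ with ∈-comprehension⁻ (inGenerated? A) y∈
  ... | a , a∈A , y≤a = ∈-comprehension⁺ (inGenerated? A) (a , a∈A , P.trans x≤y y≤a)

  minimals-isAntichain : ∀ U → IsAntichain (minimals U)
  minimals-isAntichain U x∈ y∈ x≤y =
    proj₂ (∈-comprehension⁻ (minimal? U) y∈) _
          (proj₁ (∈-comprehension⁻ (minimal? U) x∈)) x≤y

  ρ : Antichain → Antichain
  ρ (mkAntichain A _) =
    mkAntichain (minimals (∁ (generated A))) (minimals-isAntichain _)

  ρ̂ : Ideal → Ideal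
  ρ̂ (mkIdeal I _) =
    mkIdeal (generated (minimals (∁ I))) (generated-isIdeal _)

  indicator : Fin n → Subset n → ℤ
  indicator x A = if does (x ∈? A) then 1ℤ else 0ℤ

  χ[_] : Fin n → Antichain → ℤ
  χ[ x ] A = indicator x (Antichain.set A)

  χ̂[_] : Fin n → Ideal → ℤ
  χ̂[ x ] I = indicator x (Ideal.set I)

  χ : Antichain → ℤ
  χ A = + ∣ Antichain.set A ∣

------------------------------------------------------------------------
-- Fences

-- The i-th part and the i-th segment are indexed by the element of Fin s
-- whose toℕ is i ∸ 1; shared elements are indexed by ℕ, starting at 1.

module Fence {s : ℕ} (α : Vec ℕ s) where

  p : ℕ → ℕ
  p i = sum (List.take i (toList α))

  n : ℕ
  n = p s ∸ 1

  -- The element x_k, for 1 ≤ k ≤ n, is the element of Fin n with label k.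

  label : Fin n → ℕ
  label x = suc (toℕ x)

  InStep : Fin s → ℕ → Set
  InStep i k = p (toℕ i) ≤ k × k < p (suc (toℕ i))

  OddSegment EvenSegment : Fin s → Set
  OddSegment  i = ¬ (2 ∣ suc (toℕ i))
  EvenSegment i = 2 ∣ suc (toℕ i)

  data _⋖_ (x y : Fin n) : Set where
    up   : ∀ i → OddSegment i  → InStep i (label x) → label y ≡ suc (label x) → x ⋖ y
    down : ∀ i → EvenSegment i → InStep i (label y) → label x ≡ suc (label y) → x ⋖ y

  infix 4 _⊑_ _⊑?_

  _⊑_ : Rel (Fin n) 0ℓ
  _⊑_ = Star _⋖_

  -- Deciding _⊑_: comparable elements are joined by a monotone path.

  private

    sum-take-mono : ∀ (xs : List ℕ) {i j} → i ≤ j →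
                    sum (List.take i xs) ≤ sum (List.take j xs)
    sum-take-mono xs       z≤n       = z≤n
    sum-take-mono []       (s≤s _)   = z≤n
    sum-take-mono (x ∷ xs) (s≤s i≤j) = +-monoʳ-≤ x (sum-take-mono xs i≤j)

    p-mono : ∀ {i j} → i ≤ j → p i ≤ p j
    p-mono = sum-take-mono (toList α)

    inStep-unique : ∀ {i j k} → InStep i k → InStep j k → i ≡ j
    inStep-unique {i} {j} (a , b) (c , d) with <-cmp (toℕ i) (toℕ j)
    ... | tri< i<j _ _ = contradiction (<-≤-trans b (≤-trans (p-mono i<j) c)) (<-irrefl refl)
    ... | tri≈ _ i≡j _ = toℕ-injective i≡j
    ... | tri> _ _ j<i = contradiction (<-≤-trans d (≤-trans (p-mono j<i) a)) (<-irrefl refl)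

    Rise Fall : ℕ → Set
    Rise k = ∃ λ i → OddSegment i × InStep i k
    Fall k = ∃ λ i → EvenSegment i × InStep i k

    inStep? : ∀ i k → Dec (InStep i k)
    inStep? i k = (p (toℕ i) ≤? k) ×-dec (k <? p (suc (toℕ i)))

    rise? : Decidable Rise
    rise? k = any? λ i → ¬? (2 ∣? suc (toℕ i)) ×-dec inStep? i k

    fall? : Decidable Fall
    fall? k = any? λ i → (2 ∣? suc (toℕ i)) ×-dec inStep? i k

    rise-fall : ∀ {k} → Rise k → Fall k → ∀ {A : Set} → A
    rise-fall (i , odd , a) (j , even , b) with refl ← inStep-unique {i} {j} a b =
      ⊥-elim (odd even)

    Between : (ℕ → Set) → ℕ → ℕ → Set
    Between Q k l = k ≤ l × (∀ {m} → m < l → k ≤ m → Q m)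

    between? : ∀ {Q} → Decidable Q → ∀ k l → Dec (Between Q k l)
    between? Q? k l = (k ≤? l) ×-dec allUpTo? (λ m → (k ≤? m) →-dec Q? m) l

    Path : ℕ → ℕ → Set
    Path k l = Between Rise k l ⊎ Between Fall l k

    path-refl : ∀ {k} → Path k k
    path-refl = inj₁ (≤-refl , λ m<k k≤m → contradiction k≤m (<⇒≱ m<k))

    path-antisym : ∀ {k l} → Path k l → Path l k → k ≡ l
    path-antisym (inj₁ (k≤l , _)) (inj₁ (l≤k , _)) = ≤-antisym k≤l l≤k
    path-antisym (inj₂ (l≤k , _)) (inj₂ (k≤l , _)) = ≤-antisym k≤l l≤k
    path-antisym (inj₁ (k≤l , f)) (inj₂ (_ , g)) with m≤n⇒m<n∨m≡n k≤l
    ... | inj₁ k<l = rise-fall (f k<l ≤-refl) (g k<l ≤-refl)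
    ... | inj₂ k≡l = k≡l
    path-antisym (inj₂ (l≤k , f)) (inj₁ (_ , g)) with m≤n⇒m<n∨m≡n l≤k
    ... | inj₁ l<k = rise-fall (g l<k ≤-refl) (f l<k ≤-refl)
    ... | inj₂ l≡k = sym l≡k

    rise-path : ∀ {k l} → Rise k → Path (suc k) l → Path k l
    rise-path {k} r (inj₁ (k<l , f)) = inj₁ (<⇒≤ k<l , g)
      where
      g : ∀ {m} → m < _ → k ≤ m → Rise m
      g m<l k≤m with m≤n⇒m<n∨m≡n k≤m
      ... | inj₁ k<m  = f m<l k<m
      ... | inj₂ refl = r
    rise-path {k} r (inj₂ (l≤ , f)) with m≤n⇒m<n∨m≡n l≤
    ... | inj₁ l<1+k = rise-fall r (f ≤-refl (s≤s⁻¹ l<1+k))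
    ... | inj₂ refl  = inj₁ (n≤1+n k , λ m<1+k k≤m →
                         subst Rise (≤-antisym k≤m (s≤s⁻¹ m<1+k)) r)

    fall-path : ∀ {k l} → Fall k → Path k l → Path (suc k) l
    fall-path {k} d (inj₂ (l≤k , f)) = inj₂ (m≤n⇒m≤1+n l≤k , g)
      where
      g : ∀ {m} → m < suc k → _ ≤ m → Fall m
      g m<1+k l≤m with m≤n⇒m<n∨m≡n (s≤s⁻¹ m<1+k)
      ... | inj₁ m<k  = f m<k l≤m
      ... | inj₂ refl = d
    fall-path {k} d (inj₁ (k≤l , f)) with m≤n⇒m<n∨m≡n k≤l
    ... | inj₁ k<l  = rise-fall (f k<l ≤-refl) d
    ... | inj₂ refl = inj₂ (n≤1+n k , λ m<1+k k≤m →
                        subst Fall (≤-antisym k≤m (s≤s⁻¹ m<1+k)) d)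

    ⊑⇒path : ∀ {x y} → x ⊑ y → Path (label x) (label y)
    ⊑⇒path ε = path-refl
    ⊑⇒path {x} {y} (up i o a eq ◅ ps) =
      rise-path (i , o , a) (subst (λ k → Path k (label y)) eq (⊑⇒path ps))
    ⊑⇒path {x} {y} (down i e a eq ◅ ps) =
      subst (λ k → Path k (label y)) (sym eq) (fall-path (i , e , a) (⊑⇒path ps))

    pred-element : ∀ {k} (z : Fin n) → toℕ z ≡ suc k → ∃ λ (z′ : Fin n) → toℕ z′ ≡ k
    pred-element z eq = fromℕ< k<n , toℕ-fromℕ< k<n
      where k<n = <-trans (n<1+n _) (subst (_< n) eq (toℕ<n z))

    rising : ∀ d x y → toℕ y ≡ toℕ x + d → Between Rise (label x) (label y) → x ⊑ y
    rising zero x y eq _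
      with refl ← toℕ-injective {i = y} {j = x} (trans eq (+-identityʳ _)) = ε
    rising (suc d) x y eq (_ , f)
      with y′ , eq′ ← pred-element y (trans eq (+-suc (toℕ x) d)) = path (f last x≤y′)
      where
      y≡ : label y ≡ suc (label y′)
      y≡ = cong suc (trans eq (trans (+-suc (toℕ x) d) (cong suc (sym eq′))))
      last : label y′ < label y
      last = ≤-reflexive (sym y≡)
      x≤y′ : label x ≤ label y′
      x≤y′ = s≤s (subst (toℕ x ≤_) (sym eq′) (m≤m+n (toℕ x) d))
      path : Rise (label y′) → x ⊑ y
      path (i , o , a) =
        rising d x y′ eq′ (x≤y′ , λ m< → f (<-trans m< last)) ◅◅ (up i o a y≡ ◅ ε)

    falling : ∀ d x y → toℕ y ≡ toℕ x + d → Between Fall (label x) (label y) → y ⊑ x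
    falling zero x y eq _
      with refl ← toℕ-injective {i = y} {j = x} (trans eq (+-identityʳ _)) = ε
    falling (suc d) x y eq (_ , f)
      with y′ , eq′ ← pred-element y (trans eq (+-suc (toℕ x) d)) = path (f last x≤y′)
      where
      y≡ : label y ≡ suc (label y′)
      y≡ = cong suc (trans eq (trans (+-suc (toℕ x) d) (cong suc (sym eq′))))
      last : label y′ < label y
      last = ≤-reflexive (sym y≡)
      x≤y′ : label x ≤ label y′
      x≤y′ = s≤s (subst (toℕ x ≤_) (sym eq′) (m≤m+n (toℕ x) d))
      path : Fall (label y′) → y ⊑ x
      path (i , e , a) =
        down i e a y≡ ◅ falling d x y′ eq′ (x≤y′ , λ m< → f (<-trans m< last))

    path⇒⊑ : ∀ {x y} → Path (label x) (label y) → x ⊑ y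
    path⇒⊑ {x} {y} (inj₁ b@(x≤y , _)) =
      rising (toℕ y ∸ toℕ x) x y (sym (m+[n∸m]≡n (s≤s⁻¹ x≤y))) b
    path⇒⊑ {x} {y} (inj₂ b@(y≤x , _)) =
      falling (toℕ x ∸ toℕ y) y x (sym (m+[n∸m]≡n (s≤s⁻¹ y≤x))) b

  _⊑?_ : Decidable₂ _⊑_
  x ⊑? y = map′ path⇒⊑ ⊑⇒path
    (between? rise? (label x) (label y) ⊎-dec between? fall? (label y) (label x))

  ⊑-isDecPartialOrder : IsDecPartialOrder _≡_ _⊑_
  ⊑-isDecPartialOrder = record
    { isPartialOrder = record
      { isPreorder = record
        { isEquivalence = isEquivalence
        ; reflexive     = λ { refl → ε }
        ; trans         = _◅◅_
        }
      ; antisym = λ x⊑y y⊑x → toℕ-injective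
          (suc-injective (path-antisym (⊑⇒path x⊑y) (⊑⇒path y⊑x)))
      }
    ; _≟_  = _≟ᶠ_
    ; _≤?_ = _⊑?_
    }

  open Rowmotion ⊑-isDecPartialOrder public

  InSegment : Fin s → Fin n → Set
  InSegment i x = p (toℕ i) ≤ label x × label x ≤ p (suc (toℕ i))

  inSegment? : ∀ i → Decidable (InSegment i)
  inSegment? i x = (p (toℕ i) ≤? label x) ×-dec (label x ≤? p (suc (toℕ i)))

  Unshared : Fin s → Fin n → Set
  Unshared i x = InSegment i x × (∀ j → InSegment j x → j ≡ i)

  unshared? : ∀ i → Decidable (Unshared i)
  unshared? i x = inSegment? i x ×-dec all? λ j → inSegment? j x →-dec (j ≟ᶠ i)

  -- IsUnshared i j x says that x = s_{i,j}.

  IsUnshared : Fin s → ℕ → Fin n → Set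
  IsUnshared i j x =
    Unshared i x ×
    length (filter (λ y → unshared? i y ×-dec (y ⊑? x)) (allFin n)) ≡ j

  -- IsShared i x says that x = s_i; no element is s_0 or s_s.

  IsShared : ℕ → Fin n → Set
  IsShared i x = (1 ≤ i × i < s) × label x ≡ p i

  ContainsShared : ℕ → Antichain → Set
  ContainsShared i A = ∃ λ x → IsShared i x × x ∈ Antichain.set A

  isShared? : ∀ i → Decidable (IsShared i)
  isShared? i x = ((1 ≤? i) ×-dec (i <? s)) ×-dec (label x ≟ p i)

  containsShared? : ∀ i → Decidable (ContainsShared i)
  containsShared? i A = any? λ x → isShared? i x ×-dec (x ∈? Antichain.set A)

  -- χₛ i is χ_{s_i}, which is zero for i = 0 and i = s.

  χₛ : ℕ → Antichain → ℤ
  χₛ i A = if does (containsShared? i A) then 1ℤ else 0ℤ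

  r : ℕ → Orbit ρ → ℕ
  r i O = length (filter (containsShared? i) (elements O))

{-# OPTIONS --safe #-}
module Submission where

open import Defs
open import Algebra.Bundles using (module AbelianGroup)
open import Data.Bool.Base using (if_then_else_; true; false)
open import Data.Fin.Base as Fin using (Fin; zero; toℕ; fromℕ<)
open import Data.Fin.Induction using (po-wellFounded)
open import Data.Fin.Properties using (any?; toℕ-injective; toℕ<n; toℕ-fromℕ<) renaming (_≟_ to _≟ᶠ_)
open import Data.Fin.Subset using (Subset; _∈_; _∉_; ∁; ∣_∣)
open import Data.Fin.Subset.Properties using (_∈?_; x∈∁p⇒x∉p; x∉p⇒x∈∁p; ⊆-antisym)
open import Data.Integer.Base as ℤ using (ℤ; +_; _+_; _-_; _*_; -_; 0ℤ; 1ℤ)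
import Data.Integer.Properties as ℤ
open import Data.Integer.Tactic.RingSolver using (solve-∀)
open import Data.List.Base as List using (List; []; _∷_; _++_; length; filter)
open import Data.List.Membership.Propositional using () renaming (_∈_ to _∈ˡ_)
open import Data.List.Membership.Propositional.Properties
  using (∈-∃++; ∈-map⁺; ∈-map⁻; ∈-++⁺ˡ; ∈-++⁺ʳ; ∈-++⁻)
open import Data.List.Properties using (length-map; length-++-sucʳ; map-∘)
open import Data.List.Relation.Binary.Permutation.Propositional as ↭
  using (_↭_; ↭-refl; ↭-sym; prep; swap)
open import Data.List.Relation.Binary.Permutation.Propositional.Properties using (shift; ∈-resp-↭)
open import Data.List.Relation.Unary.All as All using ()
open import Data.List.Relation.Unary.AllPairs using ([]; _∷_)
open import Data.List.Relation.Unary.Any using (here; there)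
open import Data.List.Relation.Unary.Unique.Propositional using (Unique)
import Data.List.Relation.Unary.Unique.Propositional.Properties as Unique
open import Data.Nat.Base as ℕ using (ℕ; suc; _≤_; _<_; _∸_; z≤n; s≤s; s≤s⁻¹; z<s)
open import Data.Nat.Divisibility
  using (_∣_; _∣?_; divides; ∣m+n∣m⇒∣n; ∣1⇒≡1; ∣m∣n⇒∣m+n; ∣-refl; _∣0; ∣⇒≤; m∣m*n)
open import Data.Nat.ListAction using (sum)
import Data.Nat.Properties as ℕ
open import Data.Product.Base using (_×_; _,_; ∃; proj₁; proj₂)
open import Data.Rational.Base using (0ℚ; 1ℚ; _/_)
import Data.Rational.Properties as ℚ
open import Data.Rational.Unnormalised.Base as ℚᵘ using (mkℚᵘ)
open import Data.Sum.Base as Sum using (_⊎_; inj₁; inj₂; [_,_]′)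
open import Data.Vec.Base as Vec using (Vec; lookup; head; last; toList)
open import Function.Base using (_∘_; id)
open import Function.Bundles using (mk⇔; module Equivalence)
open import Function.Definitions using (Injective)
open import Induction.WellFounded using (Acc; acc)
open import Level using (0ℓ)
open import Relation.Binary.Construct.Closure.Equivalence using (EqClosure; gmap)
open import Relation.Binary.Construct.Closure.ReflexiveTransitive using (ε; _◅_; _◅◅_)
open import Relation.Binary.Construct.Closure.Symmetric using (fwd; bwd)
open import Relation.Binary.Core using (Rel)
open import Relation.Binary.PropositionalEquality
open import Relation.Binary.Structures using (IsDecPartialOrder)
open import Relation.Nullary using (Dec; yes; no; does; ¬_; contradiction; recompute)
open import Relation.Nullary.Decidable using (_×-dec_; ¬?; decidable-stable; toSum)
open import Relation.Unary using (Pred; Decidable)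

open import Algebra.Properties.Group (AbelianGroup.group ℤ.+-0-abelianGroup)
  using () renaming (∙-cancelʳ to +-cancelʳ)

-- Fix an orbit of N antichains A, and let I be the ideal generated by A. For a label k let T(k), G(k)
-- and U(k) count the A with x_k ∈ A, x_k ∈ I and x_k ∉ I; all three are 0 when there is no x_k, and
-- G(k) + U(k) = N otherwise. An unshared element has at most one upper and one lower cover, so along a
-- segment numbered 0, …, ℓ from its bottom to its top, with the shared elements (present or not) at
-- the ends, and for 0 < j < ℓ,
--     G(j) = T(j) + G(j+1),  U(j) = T(j) + U(j−1),  G(ℓ) = T(ℓ),  U(0) = T(0),
-- where the formulas for U use that ρ permutes the orbit. Hence T is constant on 0 < j < ℓ, U is an
-- arithmetic progression, and ℓ T(j) + T(ℓ) + T(0) = N; (a), (b) and (d) follow, and so does (c)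
-- because T(0) = 0 on the first segment. Running through the segments, (b) taken modulo 2 gives (e),
-- and summed it gives (f). Orbits of ρ̂ are handled through I ↦ min(P \ I), which carries ρ̂ to ρ.

-- Indicators and sums over lists

⟦_⟧ : ∀ {P : Set} → Dec P → ℤ
⟦ P? ⟧ = if does P? then 1ℤ else 0ℤ

⟦⟧-cong : ∀ {P Q : Set} (P? : Dec P) (Q? : Dec Q) → (P → Q) → (Q → P) → ⟦ P? ⟧ ≡ ⟦ Q? ⟧
⟦⟧-cong (yes _) (yes _) _ _ = refl
⟦⟧-cong (no _)  (no _)  _ _ = refl
⟦⟧-cong (yes p) (no ¬q) f _ = contradiction (f p) ¬q
⟦⟧-cong (no ¬p) (yes q) _ g = contradiction (g q) ¬p

-- Pointwise source of the relations between `T`, `G` and `U` on a segment: a membership splits into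
-- two exclusive cases, so its indicator is a sum.
⟦⟧-⊎ : ∀ {P Q R : Set} (P? : Dec P) (Q? : Dec Q) (R? : Dec R) →
       (P → Q ⊎ R) → (Q → P) → (R → P) → (Q → ¬ R) → ⟦ P? ⟧ ≡ ⟦ Q? ⟧ + ⟦ R? ⟧
⟦⟧-⊎ (yes p) (yes q) (yes r) _ _ _ h = contradiction r (h q)
⟦⟧-⊎ (yes p) (yes q) (no ¬r) _ _ _ _ = refl
⟦⟧-⊎ (yes p) (no ¬q) (yes r) _ _ _ _ = refl
⟦⟧-⊎ (yes p) (no ¬q) (no ¬r) f _ _ _ with f p
... | inj₁ q = contradiction q ¬q
... | inj₂ r = contradiction r ¬r
⟦⟧-⊎ (no ¬p) (yes q) _       _ g _ _ = contradiction (g q) ¬p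
⟦⟧-⊎ (no ¬p) (no ¬q) (yes r) _ _ h _ = contradiction (h r) ¬p
⟦⟧-⊎ (no ¬p) (no ¬q) (no ¬r) _ _ _ _ = refl

⟦⟧-true : ∀ {P : Set} (P? : Dec P) → P → ⟦ P? ⟧ ≡ 1ℤ
⟦⟧-true (yes _) _ = refl
⟦⟧-true (no ¬p) p = contradiction p ¬p

⟦⟧-false : ∀ {P : Set} (P? : Dec P) → ¬ P → ⟦ P? ⟧ ≡ 0ℤ
⟦⟧-false (yes p) ¬p = contradiction p ¬p
⟦⟧-false (no _)  _  = refl

∑ : ∀ {X : Set} → (X → ℤ) → List X → ℤ
∑ st xs = List.foldr _+_ 0ℤ (List.map st xs)

interchange : ∀ a b c d → (a + b) + (c + d) ≡ (a + c) + (b + d)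
interchange = solve-∀

module _ {X : Set} where

  ∑-cong : ∀ {st st′ : X → ℤ} → (∀ x → st x ≡ st′ x) → ∀ xs → ∑ st xs ≡ ∑ st′ xs
  ∑-cong eq []       = refl
  ∑-cong eq (x ∷ xs) = cong₂ _+_ (eq x) (∑-cong eq xs)

  ∑-+ : ∀ (st st′ : X → ℤ) xs → ∑ (λ x → st x + st′ x) xs ≡ ∑ st xs + ∑ st′ xs
  ∑-+ st st′ []       = refl
  ∑-+ st st′ (x ∷ xs) =
    trans (cong (_+_ (st x + st′ x)) (∑-+ st st′ xs)) (interchange (st x) (st′ x) _ _)

  ∑-* : ∀ c (st : X → ℤ) xs → ∑ (λ x → c * st x) xs ≡ c * ∑ st xs
  ∑-* c st []       = sym (ℤ.*-zeroʳ c)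
  ∑-* c st (x ∷ xs) =
    trans (cong (_+_ (c * st x)) (∑-* c st xs)) (sym (ℤ.*-distribˡ-+ c (st x) _))

  ∑-neg : ∀ (st : X → ℤ) xs → ∑ (λ x → - st x) xs ≡ - ∑ st xs
  ∑-neg st []       = refl
  ∑-neg st (x ∷ xs) =
    trans (cong (_+_ (- st x)) (∑-neg st xs)) (sym (ℤ.neg-distrib-+ (st x) _))

  ∑-1 : ∀ (xs : List X) → ∑ (λ _ → 1ℤ) xs ≡ + length xs
  ∑-1 []       = refl
  ∑-1 (x ∷ xs) = cong (_+_ 1ℤ) (∑-1 xs)

  ∑-0 : ∀ (xs : List X) → ∑ (λ _ → 0ℤ) xs ≡ 0ℤ
  ∑-0 []       = refl
  ∑-0 (x ∷ xs) = trans (ℤ.+-identityˡ _) (∑-0 xs)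

  ∑-↭ : ∀ (st : X → ℤ) {xs ys} → xs ↭ ys → ∑ st xs ≡ ∑ st ys
  ∑-↭ st ↭.refl       = refl
  ∑-↭ st (prep x p)   = cong (_+_ (st x)) (∑-↭ st p)
  ∑-↭ st (swap x y p) =
    trans (cong (λ z → st x + (st y + z)) (∑-↭ st p)) (exchange (st x) (st y) _)
    where
    exchange : ∀ a b c → a + (b + c) ≡ b + (a + c)
    exchange = solve-∀
  ∑-↭ st (↭.trans p q) = trans (∑-↭ st p) (∑-↭ st q)

  ∑-⟦⟧ : ∀ {P : Pred X 0ℓ} (P? : Decidable P) xs → ∑ (λ x → ⟦ P? x ⟧) xs ≡ + length (filter P? xs)
  ∑-⟦⟧ P? []       = refl
  ∑-⟦⟧ P? (x ∷ xs) with P? x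
  ... | yes _ = cong (_+_ 1ℤ) (∑-⟦⟧ P? xs)
  ... | no  _ = trans (ℤ.+-identityˡ _) (∑-⟦⟧ P? xs)

  -- By induction, deleting from `ys` one occurrence of the head `x`. Since `x` does not recur in
  -- `xs`, the remaining entries survive the deletion.
  unique-⊆⇒↭ : ∀ {xs ys : List X} → Unique xs → (∀ {x} → x ∈ˡ xs → x ∈ˡ ys) →
               length xs ≡ length ys → xs ↭ ys
  unique-⊆⇒↭ {[]}     {[]}    _ _ _ = ↭-refl
  unique-⊆⇒↭ {x ∷ xs} {ys} (x∉ ∷ u) xs⊆ys len
    with as , bs , refl ← ∈-∃++ (xs⊆ys (here refl)) =
    ↭.trans (prep x (unique-⊆⇒↭ u sub len′)) (↭-sym (shift x as bs))
    where
    len′ : length xs ≡ length (as ++ bs)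
    len′ = ℕ.suc-injective (trans len (length-++-sucʳ as x bs))
    sub : ∀ {z} → z ∈ˡ xs → z ∈ˡ as ++ bs
    sub z∈ with ∈-++⁻ as (xs⊆ys (there z∈))
    ... | inj₁ z∈as         = ∈-++⁺ˡ z∈as
    ... | inj₂ (here refl)  = contradiction refl (All.lookup x∉ z∈)
    ... | inj₂ (there z∈bs) = ∈-++⁺ʳ as z∈bs

∑-map : ∀ {X Y : Set} (g : X → Y) (st : Y → ℤ) xs → ∑ st (List.map g xs) ≡ ∑ (st ∘ g) xs
∑-map g st xs = cong (List.foldr _+_ 0ℤ) (sym (map-∘ xs))

-- Maps acting on orbits

module _ {X : Set} {f : X → X} (f-injective : Injective _≡_ _≡_ f) (O : Orbit f) where

  elements-closed : ∀ {x} → x ∈ˡ elements O → f x ∈ˡ elements O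
  elements-closed x∈ =
    Equivalence.from (Orbit.spec O _) (Equivalence.to (Orbit.spec O _) x∈ ◅◅ (fwd refl ◅ ε))

  -- The image list has no repetitions by injectivity, stays in the orbit, and has the same length,
  -- so it is a rearrangement. In particular orbit elements have predecessors in the orbit.
  map-elements-↭ : List.map f (elements O) ↭ elements O
  map-elements-↭ = unique-⊆⇒↭ (Unique.map⁺ f-injective (Orbit.unique O)) sub
                              (length-map f (elements O))
    where
    sub : ∀ {y} → y ∈ˡ List.map f (elements O) → y ∈ˡ elements O
    sub y∈ with _ , x∈ , refl ← ∈-map⁻ f y∈ = elements-closed x∈

  preimage : ∀ {y} → y ∈ˡ elements O → ∃ λ x → x ∈ˡ elements O × y ≡ f x
  preimage y∈ = ∈-map⁻ f (∈-resp-↭ (↭-sym map-elements-↭) y∈)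

  total-∘ : ∀ st → total (st ∘ f) O ≡ total st O
  total-∘ st = trans (sym (∑-map f st (elements O))) (∑-↭ st map-elements-↭)

module _ {X Y : Set} {f : X → X} {g : Y → Y}
         (f-injective : Injective _≡_ _≡_ f) (g-injective : Injective _≡_ _≡_ g)
         (φ : X → Y) (φ-injective : Injective _≡_ _≡_ φ) (φ-commutes : ∀ x → φ (f x) ≡ g (φ x))
         where

  -- Needed because the hypothesis of (d) is about orbits of `ρ` while its conclusion is about
  -- orbits of `ρ̂`.
  image-orbit : Orbit f → Orbit g
  image-orbit O = record
    { elements = List.map φ (elements O)
    ; unique   = Unique.map⁺ φ-injective (Orbit.unique O)
    ; base     = φ (Orbit.base O)
    ; spec     = λ y → mk⇔ to (from (∈-map⁺ φ (Equivalence.from (Orbit.spec O _) ε)))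
    }
    where
    to : ∀ {y} → y ∈ˡ List.map φ (elements O) → EqClosure (λ a b → g a ≡ b) (φ (Orbit.base O)) y
    to y∈ with x , x∈ , refl ← ∈-map⁻ φ y∈ =
      gmap φ (λ {a} eq → trans (sym (φ-commutes a)) (cong φ eq)) (Equivalence.to (Orbit.spec O x) x∈)

    from : ∀ {y z} → y ∈ˡ List.map φ (elements O) → EqClosure (λ a b → g a ≡ b) y z →
           z ∈ˡ List.map φ (elements O)
    from y∈ ε = y∈
    from y∈ (fwd refl ◅ p) with x , x∈ , refl ← ∈-map⁻ φ y∈ =
      from (subst (_∈ˡ _) (φ-commutes x) (∈-map⁺ φ (elements-closed f-injective O x∈))) p
    -- A backward step: `x` has a predecessor `x′` in the orbit of `f`, and injectivity of `g`
    -- identifies the new point with `φ x′`.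
    from y∈ (bwd gz≡y ◅ p) with x , x∈ , refl ← ∈-map⁻ φ y∈
      with x′ , x′∈ , refl ← preimage f-injective O x∈ =
      from (subst (_∈ˡ _) (sym (g-injective (trans gz≡y (φ-commutes x′)))) (∈-map⁺ φ x′∈)) p

-- Averages as fractions

-- Normalised fractions are compared through unnormalised ones, where equality is
-- cross-multiplication by definition.
/-cross : ∀ m n d e .{{_ : ℕ.NonZero d}} .{{_ : ℕ.NonZero e}} →
          m * + e ≡ n * + d → m / d ≡ n / e
/-cross m n (suc d) (suc e) eq = ℚ.fromℚᵘ-cong {mkℚᵘ m d} {mkℚᵘ n e} (ℚᵘ.*≡* eq)

module _ {X : Set} {f : X → X} where

  average-≡ : ∀ (st : X → ℤ) (O : Orbit f) a d .{{_ : ℕ.NonZero d}} →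
              + d * total st O ≡ a * + (# O) → average st O ≡ a / d
  average-≡ st O a d eq =
    /-cross (total st O) a (# O) d {{#-nonZero O}} (trans (ℤ.*-comm (total st O) (+ d)) eq)

-- Counts along one segment

record IsProgression (ℓ : ℕ) (N : ℤ) (T U G : ℕ → ℤ) : Set where
  field
    bottom  : U 0 ≡ T 0
    top     : G ℓ ≡ T ℓ
    ascend  : ∀ {j} → suc j < ℓ → U (suc j) ≡ T (suc j) + U j
    descend : ∀ {j} → suc j < ℓ → G (suc j) ≡ T (suc j) + G (suc (suc j))
    -- Only interior positions are included: positions `0` and `ℓ` may belong to no element.
    whole   : ∀ {j} → suc j < ℓ → G (suc j) + U (suc j) ≡ N

  -- Both `G + U = N` at position `j + 2`, with `U` expanded downwards, and `G + U = N` at position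
  -- `j + 1`, with `G` expanded upwards, contain `G (j + 2) + U (j + 1)`; cancelling it leaves the
  -- two values of `T`.
  step : ∀ {j} → suc (suc j) < ℓ → T (suc (suc j)) ≡ T (suc j)
  step {j} j< = +-cancelʳ (G (suc (suc j)) + U (suc j)) _ _ (begin
    T (suc (suc j)) + (G (suc (suc j)) + U (suc j))
      ≡⟨ exchange (T (suc (suc j))) (G (suc (suc j))) (U (suc j)) ⟩
    G (suc (suc j)) + (T (suc (suc j)) + U (suc j))  ≡⟨ cong (_+_ (G (suc (suc j)))) (ascend j<) ⟨
    G (suc (suc j)) + U (suc (suc j))                ≡⟨ whole j< ⟩
    N                                                ≡⟨ whole j<′ ⟨
    G (suc j) + U (suc j)                            ≡⟨ cong (_+ U (suc j)) (descend j<′) ⟩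
    T (suc j) + G (suc (suc j)) + U (suc j)          ≡⟨ ℤ.+-assoc (T (suc j)) _ _ ⟩
    T (suc j) + (G (suc (suc j)) + U (suc j))        ∎)
    where
    open ≡-Reasoning
    j<′ = ℕ.<-trans (ℕ.n<1+n _) j<
    exchange : ∀ a b c → a + (b + c) ≡ b + (a + c)
    exchange = solve-∀

  constant₁ : ∀ {j} → suc j < ℓ → T (suc j) ≡ T 1
  constant₁ {ℕ.zero} _  = refl
  constant₁ {suc j}  j< = trans (step j<) (constant₁ (ℕ.<-trans (ℕ.n<1+n _) j<))

  constant : ∀ {j k} → suc j < ℓ → suc k < ℓ → T (suc j) ≡ T (suc k)
  constant j< k< = trans (constant₁ j<) (sym (constant₁ k<))

  -- Telescoping of `ascend` down to `bottom`, all increments being equal by `step`.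
  linear : ∀ {j} → suc j < ℓ → U (suc j) ≡ T 0 + + suc j * T (suc j)
  linear {ℕ.zero} j< = trans (ascend j<)
    (trans (cong (_+_ (T 1)) bottom) (base (T 1) (T 0)))
    where
    base : ∀ a b → a + b ≡ b + 1ℤ * a
    base = solve-∀
  linear {suc j} j< = begin
    U (suc (suc j))                                   ≡⟨ ascend j< ⟩
    T (suc (suc j)) + U (suc j)                       ≡⟨ cong (_+_ (T (suc (suc j)))) (linear j<′) ⟩
    T (suc (suc j)) + (T 0 + + suc j * T (suc j))
      ≡⟨ cong (λ t → T (suc (suc j)) + (T 0 + + suc j * t)) (step j<) ⟨
    T (suc (suc j)) + (T 0 + + suc j * T (suc (suc j)))
      ≡⟨ collect (T (suc (suc j))) (T 0) (+ suc j) ⟩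
    T 0 + + suc (suc j) * T (suc (suc j))             ∎
    where
    open ≡-Reasoning
    j<′ = ℕ.<-trans (ℕ.n<1+n _) j<
    collect : ∀ t b k → t + (b + k * t) ≡ b + (1ℤ + k) * t
    collect = solve-∀

  -- `G + U = N` is evaluated at the highest interior position, where `G` is the sum of only two
  -- values of `T` and `U` is given by `linear`.
  sum-law : ∀ {j} → suc j < ℓ → + ℓ * T (suc j) + (T ℓ + T 0) ≡ N
  sum-law {j} j< = subst (λ l → + l * T (suc j) + (T l + T 0) ≡ N) (sym ℓ≡) (begin
    + suc k * T (suc j) + (T (suc k) + T 0)    ≡⟨ cong (λ t → + suc k * t + (T (suc k) + T 0)) T≡ ⟩
    + suc k * T k + (T (suc k) + T 0)          ≡⟨ split (+ k) (T k) (T (suc k)) (T 0) ⟩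
    T k + T (suc k) + (T 0 + + k * T k)        ≡⟨ cong₂ _+_ G≡ (linear k<) ⟨
    G k + U k                                  ≡⟨ whole k< ⟩
    N                                          ∎)
    where
    open ≡-Reasoning
    -- This choice makes `k` equal to `ℓ − 1`.
    i = ℓ ∸ suc (suc j)
    k = suc (j ℕ.+ i)
    ℓ≡ : ℓ ≡ suc k
    ℓ≡ = sym (ℕ.m+[n∸m]≡n j<)
    k< : k < ℓ
    k< = ℕ.≤-reflexive (sym ℓ≡)
    T≡ : T (suc j) ≡ T k
    T≡ = constant j< k<
    G≡ : G k ≡ T k + T (suc k)
    G≡ = trans (descend k<) (cong (_+_ (T k)) (subst (λ l → G l ≡ T l) ℓ≡ top))
    split : ∀ k t u b → (1ℤ + k) * t + (u + b) ≡ t + u + (b + k * t)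
    split = solve-∀

-- Injectivity of rowmotion on a finite poset

module RowmotionProperties {n} {_≤ᴾ_ : Rel (Fin n) 0ℓ}
                           (isDecPartialOrder : IsDecPartialOrder _≡_ _≤ᴾ_) where

  open Rowmotion isDecPartialOrder
  private module P = IsDecPartialOrder isDecPartialOrder

  -- The proof field is irrelevant, but what it proves is decidable and can therefore be recomputed.
  antichain : (A : Antichain) → IsAntichain (Antichain.set A)
  antichain (mkAntichain A anti) x∈ y∈ x≤y = recompute (_ ≟ᶠ _) (anti x∈ y∈ x≤y)

  ideal : (I : Ideal) → IsIdeal (Ideal.set I)
  ideal (mkIdeal I down) x≤y y∈ = recompute (_ ∈? I) (down x≤y y∈)

  antichain-≡ : ∀ {A B} → Antichain.set A ≡ Antichain.set B → A ≡ B
  antichain-≡ refl = refl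

  ideal-≡ : ∀ {I J} → Ideal.set I ≡ Ideal.set J → I ≡ J
  ideal-≡ refl = refl

  -- An `x` in `A` lies below some `b` in `B`, which lies below some `a` in `A`; the antichain
  -- condition gives `x = a`, hence `x = b`.
  generated-⊆ : (A B : Antichain) → generated (Antichain.set A) ≡ generated (Antichain.set B) →
                ∀ {x} → x ∈ Antichain.set A → x ∈ Antichain.set B
  generated-⊆ A B eq {x} x∈A
    with b , b∈B , x≤b ← ∈-comprehension⁻ (inGenerated? _)
           (subst (x ∈_) eq (∈-comprehension⁺ (inGenerated? _) (x , x∈A , P.refl)))
    with a , a∈A , b≤a ← ∈-comprehension⁻ (inGenerated? _)
           (subst (b ∈_) (sym eq) (∈-comprehension⁺ (inGenerated? _) (b , b∈B , P.refl)))
    with refl ← antichain A x∈A a∈A (P.trans x≤b b≤a)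
    = subst (_∈ Antichain.set B) (P.antisym b≤a x≤b) b∈B

  generated-injective : (A B : Antichain) →
    generated (Antichain.set A) ≡ generated (Antichain.set B) → A ≡ B
  generated-injective A B eq =
    antichain-≡ (⊆-antisym (generated-⊆ A B eq) (generated-⊆ B A (sym eq)))

  minimal-below : ∀ U {x} → x ∈ U → ∃ λ y → Minimal U y × y ≤ᴾ x
  minimal-below U {x} = go (po-wellFounded P.isPartialOrder x)
    where
    go : ∀ {x} → Acc _ x → x ∈ U → ∃ λ y → Minimal U y × y ≤ᴾ x
    go {x} (acc rs) x∈U with any? (λ z → (z ∈? U) ×-dec ((z P.≤? x) ×-dec ¬? (z ≟ᶠ x)))
    ... | no none = x , (x∈U , λ z z∈U z≤x → decidable-stable (z ≟ᶠ x) λ z≢x →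
                      none (z , z∈U , z≤x , z≢x)) , P.refl
    ... | yes (z , z∈U , z<x@(z≤x , _)) with y , y-min , y≤z ← go (rs z<x) z∈U =
      y , y-min , P.trans y≤z z≤x

  -- If `x` were in `I` but not in `J`, a minimal element of the complement of `J` below `x` would
  -- also be minimal in the complement of `I`, yet lie in `I` because `I` is an ideal.
  minimals-⊆ : (I J : Ideal) → minimals (∁ (Ideal.set I)) ≡ minimals (∁ (Ideal.set J)) →
               ∀ {x} → x ∈ Ideal.set I → x ∈ Ideal.set J
  minimals-⊆ I J eq {x} x∈I = decidable-stable (x ∈? Ideal.set J) λ x∉J →
    let y , y-min , y≤x = minimal-below (∁ (Ideal.set J)) (x∉p⇒x∈∁p x∉J)
        y∈min = subst (y ∈_) (sym eq) (∈-comprehension⁺ (minimal? (∁ (Ideal.set J))) y-min)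
        y∈∁I  = proj₁ (∈-comprehension⁻ (minimal? (∁ (Ideal.set I))) y∈min)
    in x∈∁p⇒x∉p y∈∁I (ideal I y≤x x∈I)

  minimals-injective : (I J : Ideal) →
    minimals (∁ (Ideal.set I)) ≡ minimals (∁ (Ideal.set J)) → I ≡ J
  minimals-injective I J eq =
    ideal-≡ (⊆-antisym (minimals-⊆ I J eq) (minimals-⊆ J I (sym eq)))

  -- φ intertwines ρ̂ and ρ definitionally.

  φ : Ideal → Antichain
  φ (mkIdeal I _) = mkAntichain (minimals (∁ I)) (minimals-isAntichain _)

  φ-injective : Injective _≡_ _≡_ φ
  φ-injective {I} {J} eq = minimals-injective I J (cong Antichain.set eq)

  -- `ρ` is `φ` after the passage to the generated ideal, and `ρ̂` composes the same two injections
  -- in the other order.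
  ρ-injective : Injective _≡_ _≡_ ρ
  ρ-injective {A} {B} eq = generated-injective A B (cong Ideal.set
    (minimals-injective (mkIdeal (generated (Antichain.set A)) (generated-isIdeal _))
                        (mkIdeal (generated (Antichain.set B)) (generated-isIdeal _))
                        (cong Antichain.set eq)))

  ρ̂-injective : Injective _≡_ _≡_ ρ̂
  ρ̂-injective {I} {J} eq =
    φ-injective (generated-injective (φ I) (φ J) (cong Ideal.set eq))

-- Partial sums and parity

sum-take-mono : ∀ xs {i j} → i ≤ j → sum (List.take i xs) ≤ sum (List.take j xs)
sum-take-mono xs       z≤n       = z≤n
sum-take-mono []       (s≤s _)   = z≤n
sum-take-mono (x ∷ xs) (s≤s i≤j) = ℕ.+-monoʳ-≤ x (sum-take-mono xs i≤j)

sum-take-suc : ∀ {s} (α : Vec ℕ s) i →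
  sum (List.take (suc (toℕ i)) (toList α)) ≡ sum (List.take (toℕ i) (toList α)) ℕ.+ lookup α i
sum-take-suc (a Vec.∷ α) zero        = ℕ.+-identityʳ a
sum-take-suc (a Vec.∷ α) (Fin.suc i) =
  trans (cong (a ℕ.+_) (sum-take-suc α i)) (sym (ℕ.+-assoc a _ _))

¬2∣consecutive : ∀ {m} → 2 ∣ m → ¬ (2 ∣ suc m)
¬2∣consecutive {m} 2∣m 2∣1+m
  with () ← ∣1⇒≡1 (∣m+n∣m⇒∣n (subst (2 ∣_) (ℕ.+-comm 1 m) 2∣1+m) 2∣m)

2∣consecutive : ∀ m → ¬ (2 ∣ m) → 2 ∣ suc m
2∣consecutive ℕ.zero        ¬2∣0 = contradiction (2 ∣0) ¬2∣0
2∣consecutive (suc ℕ.zero)  _    = ∣-refl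
2∣consecutive (suc (suc m)) ¬2∣ = ∣m∣n⇒∣m+n ∣-refl (2∣consecutive m λ 2∣m → ¬2∣ (∣m∣n⇒∣m+n ∣-refl 2∣m))

-- The segments of a fence as chains

module FenceProperties {s} (α : Vec ℕ s) (positive : ∀ i → 1 ≤ lookup α i) where

  open Fence α
  open RowmotionProperties ⊑-isDecPartialOrder public
  private module P = IsDecPartialOrder ⊑-isDecPartialOrder

  p-mono : ∀ {i j} → i ≤ j → p i ≤ p j
  p-mono = sum-take-mono (toList α)

  p-suc : ∀ i → p (suc (toℕ i)) ≡ p (toℕ i) ℕ.+ lookup α i
  p-suc = sum-take-suc α

  p-step : ∀ i → p (toℕ i) < p (suc (toℕ i))
  p-step i = subst (p (toℕ i) <_) (sym (p-suc i)) (ℕ.m<m+n _ (positive i))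

  p-strict : ∀ {i j} → i < j → j ≤ s → p i < p j
  p-strict {i} {j} i<j j≤s =
    ℕ.<-≤-trans (subst (λ i → p i < p (suc i)) (toℕ-fromℕ< i<s) (p-step (fromℕ< i<s))) (p-mono i<j)
    where i<s = ℕ.<-≤-trans i<j j≤s

  p-cancel-< : ∀ {i j} → p i < p j → i < j
  p-cancel-< {i} {j} pi<pj = ℕ.≰⇒> λ j≤i → ℕ.<⇒≱ pi<pj (p-mono j≤i)

  p-cancel-≤ : ∀ {i j} → i ≤ s → p i ≤ p j → i ≤ j
  p-cancel-≤ i≤s pi≤pj = ℕ.≮⇒≥ λ j<i → ℕ.<⇒≱ (p-strict j<i i≤s) pi≤pj

  inStep-unique : ∀ {i j k} → InStep i k → InStep j k → toℕ i ≡ toℕ j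
  inStep-unique (a , b) (c , d) = ℕ.≤-antisym
    (s≤s⁻¹ (p-cancel-< (ℕ.≤-<-trans a d))) (s≤s⁻¹ (p-cancel-< (ℕ.≤-<-trans c b)))

  -- With `inStep-before`, this locates the two edges at a turning point, so that the parity of
  -- their segments decides their directions.
  inStep-at : ∀ {i j} → InStep j (p i) → toℕ j ≡ i
  inStep-at {i} {j} (a , b) =
    ℕ.≤-antisym (p-cancel-≤ (ℕ.<⇒≤ (toℕ<n j)) a) (s≤s⁻¹ (p-cancel-< b))

  inStep-before : ∀ {i j k} → i ≤ s → InStep j k → suc k ≡ p i → suc (toℕ j) ≡ i
  inStep-before {i} {j} i≤s (a , b) eq = ℕ.≤-antisym
    (p-cancel-< (subst (p (toℕ j) <_) eq (s≤s a))) (p-cancel-≤ i≤s (subst (_≤ p (suc (toℕ j))) eq b))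

  label≢0 : ∀ {x : Fin n} → label x ≢ 0
  label≢0 ()

  label<p : ∀ x → label x < p s
  label<p x = lemma (p s) (toℕ<n x)
    where
    lemma : ∀ q → toℕ x < q ∸ 1 → suc (toℕ x) < q
    lemma (suc q) x< = s≤s x<

  label-injective : ∀ {x y : Fin n} → label x ≡ label y → x ≡ y
  label-injective = toℕ-injective ∘ ℕ.suc-injective

  element : ∀ {k} → 0 < k → k < p s → ∃ λ x → label x ≡ k
  element {suc k} _ k< = fromℕ< k<n , cong suc (toℕ-fromℕ< k<n)
    where
    lemma : ∀ q → suc k < q → k < q ∸ 1
    lemma (suc q) = s≤s⁻¹
    k<n : k < n
    k<n = lemma (p s) k<

  -- The labels of a segment, listed from its bottom to its top; the first or the last of them is
  -- 0 or n + 1, hence not the label of an element, when the fence ends there.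

  record Chain (i : Fin s) : Set where
    field
      lab       : ℕ → ℕ
    ℓ : ℕ
    ℓ = lookup α i
    field
      cover     : ∀ {j x y} → j < ℓ → label x ≡ lab j → label y ≡ lab (suc j) → x ⋖ y
      upper     : ∀ {j x y} → suc j < ℓ → label x ≡ lab (suc j) → x ⋖ y → label y ≡ lab (suc (suc j))
      lower     : ∀ {j x y} → suc j < ℓ → label y ≡ lab (suc j) → x ⋖ y → label x ≡ lab j
      bottom    : ∀ {x y} → label y ≡ lab 0 → ¬ (x ⋖ y)
      top       : ∀ {x y} → label x ≡ lab ℓ → ¬ (x ⋖ y)
      present   : ∀ {j} → suc j < ℓ → ∃ λ x → label x ≡ lab (suc j)
      ends      : ∀ (T : ℕ → ℤ) → T (lab ℓ) + T (lab 0) ≡ T (p (suc (toℕ i))) + T (p (toℕ i))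
      position  : ∀ {k} → p (toℕ i) < k → k < p (suc (toℕ i)) → ∃ λ j → suc j < ℓ × k ≡ lab (suc j)

  module _ (i : Fin s) where
    private
      a = p (toℕ i)
      b = p (suc (toℕ i))
      ℓ = lookup α i

      b≤ps : b ≤ p s
      b≤ps = p-mono (toℕ<n i)

      inside : ∀ {k} → a < k → k < b → ∃ λ x → label x ≡ k
      inside a<k k<b = element (ℕ.≤-<-trans z≤n a<k) (ℕ.<-≤-trans k<b b≤ps)

    -- Labels grow upwards here. Every unwanted cover is refuted by locating its edge: it would make
    -- the segment `i` even, or a neighbour of `i` odd.
    rising : OddSegment i → Chain i
    rising odd = record
      { lab      = a ℕ.+_
      ; cover    = λ {j} {x} j<ℓ x≡ y≡ → up i odd (subst (InStep i) (sym x≡) (step j<ℓ))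
                     (trans y≡ (trans (ℕ.+-suc a j) (cong suc (sym x≡))))
      ; upper    = upper
      ; lower    = lower
      ; bottom   = bottom
      ; top      = top
      ; present  = λ j< → inside (ℕ.m<m+n a z<s) (below j<)
      ; ends     = λ T → cong₂ (λ u v → T u + T v) (sym (p-suc i)) (ℕ.+-identityʳ a)
      ; position = position
      }
      where
      below : ∀ {j} → j < ℓ → a ℕ.+ j < b
      below {j} j<ℓ = subst (a ℕ.+ j <_) (sym (p-suc i)) (ℕ.+-monoʳ-< a j<ℓ)

      step : ∀ {j} → j < ℓ → InStep i (a ℕ.+ j)
      step {j} j<ℓ = ℕ.m≤m+n a j , below j<ℓ

      never-even : ∀ {k m} → EvenSegment k → InStep i m → ¬ InStep k m
      never-even even c d = odd (subst (λ k → 2 ∣ suc k) (inStep-unique d c) even)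

      upper : ∀ {j x y} → suc j < ℓ → label x ≡ a ℕ.+ suc j → x ⋖ y → label y ≡ a ℕ.+ suc (suc j)
      upper {j} j< x≡ (up k _ _ y≡) = trans y≡ (trans (cong suc x≡) (sym (ℕ.+-suc a (suc j))))
      upper {j} j< x≡ (down k even st x≡y) = contradiction st (never-even even
        (subst (InStep i) (ℕ.suc-injective (trans (sym (trans x≡ (ℕ.+-suc a j))) x≡y))
               (step (ℕ.<-trans (ℕ.n<1+n j) j<))))

      lower : ∀ {j x y} → suc j < ℓ → label y ≡ a ℕ.+ suc j → x ⋖ y → label x ≡ a ℕ.+ j
      lower {j} j< y≡ (up k _ _ y≡x) = ℕ.suc-injective (trans (sym y≡x) (trans y≡ (ℕ.+-suc a j)))
      lower {j} j< y≡ (down k even st _) =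
        contradiction st (never-even even (subst (InStep i) (sym y≡) (step j<)))

      bottom : ∀ {x y} → label y ≡ a ℕ.+ 0 → ¬ (x ⋖ y)
      -- An upward edge ending at the label `a` would lie in the preceding segment, which is even.
      bottom y≡ (up k odd′ st y≡x) = odd′ (2∣consecutive′ odd
        (inStep-before (ℕ.<⇒≤ (toℕ<n i)) st (trans (sym y≡x) (trans y≡ (ℕ.+-identityʳ a)))))
        where
        2∣consecutive′ : ∀ {m k} → ¬ (2 ∣ suc m) → k ≡ m → 2 ∣ k
        2∣consecutive′ {m} ¬2∣ refl = decidable-stable (2 ∣? m) λ ¬2∣m → ¬2∣ (2∣consecutive m ¬2∣m)
      bottom y≡ (down k even st _) =
        contradiction st (never-even even (subst (InStep i) (sym y≡)
          (step (positive i))))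

      top : ∀ {x y} → label x ≡ a ℕ.+ ℓ → ¬ (x ⋖ y)
      -- An upward edge starting at the label `b` would lie in the following segment, which is even.
      top {x} x≡ (up k odd′ st _) = odd′ (subst (λ k → 2 ∣ suc k)
        (sym (inStep-at (subst (InStep k) (trans x≡ (sym (p-suc i))) st))) (2∣consecutive _ odd))
      top {x} {y} x≡ (down k even st x≡y) = odd (subst (2 ∣_)
        (inStep-before (toℕ<n i) st (trans (sym x≡y) (trans x≡ (sym (p-suc i))))) even)

      position : ∀ {k} → a < k → k < b → ∃ λ j → suc j < ℓ × k ≡ a ℕ.+ suc j
      position {k} a<k k<b =
        k ∸ suc a
        , ℕ.+-cancelˡ-< a _ _ (subst₂ _<_ k≡ (p-suc i) k<b)
        , k≡
        where
        k≡ : k ≡ a ℕ.+ suc (k ∸ suc a)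
        k≡ = trans (sym (ℕ.m+[n∸m]≡n a<k)) (sym (ℕ.+-suc a _))

    -- The mirror image of `rising`, counting down from `b`. Positions go up to `ℓ ≤ b`, so the
    -- subtraction is never truncated. Bottom and top now have the labels `b` and `a`, hence the
    -- commutation in `ends`.
    falling : EvenSegment i → Chain i
    falling even = record
      { lab      = b ∸_
      ; cover    = λ {j} {x} {y} j<ℓ x≡ y≡ → down i even (subst (InStep i) (sym y≡) (step j<ℓ))
                     (trans x≡ (trans (pred≡ j<ℓ) (cong suc (sym y≡))))
      ; upper    = upper
      ; lower    = lower
      ; bottom   = bottom
      ; top      = top
      ; present  = λ j< → inside (above j<) (proj₂ (step (ℕ.<-trans (ℕ.n<1+n _) j<)))
      ; ends     = λ T → trans (cong (λ u → T u + T b) b∸ℓ) (ℤ.+-comm (T a) (T b))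
      ; position = position
      }
      where
      b∸ℓ : b ∸ ℓ ≡ a
      b∸ℓ = trans (cong (_∸ ℓ) (p-suc i)) (ℕ.m+n∸n≡m a ℓ)

      ℓ≤b : ℓ ≤ b
      ℓ≤b = subst (ℓ ≤_) (sym (p-suc i)) (ℕ.m≤n+m ℓ a)

      pred≡ : ∀ {j} → j < ℓ → b ∸ j ≡ suc (b ∸ suc j)
      pred≡ {j} j<ℓ = ℕ.+-∸-assoc 1 (ℕ.≤-trans j<ℓ ℓ≤b)

      above : ∀ {j} → j < ℓ → a < b ∸ j
      above {j} j<ℓ = subst (_< b ∸ j) b∸ℓ (ℕ.∸-monoʳ-< j<ℓ ℓ≤b)

      step : ∀ {j} → j < ℓ → InStep i (b ∸ suc j)
      step {j} j<ℓ = subst (_≤ b ∸ suc j) b∸ℓ (ℕ.∸-monoʳ-≤ b j<ℓ)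
                   , subst (_≤ b) (pred≡ j<ℓ) (ℕ.m∸n≤m b j)

      never-odd : ∀ {k m} → OddSegment k → InStep i m → ¬ InStep k m
      never-odd odd c d = odd (subst (λ k → 2 ∣ suc k) (inStep-unique c d) even)

      upper : ∀ {j x y} → suc j < ℓ → label x ≡ b ∸ suc j → x ⋖ y → label y ≡ b ∸ suc (suc j)
      upper {j} j< x≡ (up k odd st _) = contradiction st
        (never-odd odd (subst (InStep i) (sym x≡) (step (ℕ.<-trans (ℕ.n<1+n j) j<))))
      upper {j} j< x≡ (down k _ _ x≡y) =
        ℕ.suc-injective (trans (sym x≡y) (trans x≡ (pred≡ j<)))

      lower : ∀ {j x y} → suc j < ℓ → label y ≡ b ∸ suc j → x ⋖ y → label x ≡ b ∸ j
      lower {j} j< y≡ (up k odd st y≡x) = contradiction st (never-odd odd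
        (subst (InStep i) (ℕ.suc-injective (trans (sym (pred≡ j<)) (trans (sym y≡) y≡x))) (step j<)))
      lower {j} j< y≡ (down k _ _ x≡y) =
        trans x≡y (trans (cong suc y≡) (sym (pred≡ (ℕ.<-trans (ℕ.n<1+n j) j<))))

      bottom : ∀ {x y} → label y ≡ b → ¬ (x ⋖ y)
      bottom {x} {y} y≡ (up k odd st y≡x) =
        odd (subst (2 ∣_) (sym (inStep-before (toℕ<n i) st (trans (sym y≡x) y≡))) even)
      bottom {x} {y} y≡ (down k even′ st _) = ¬2∣consecutive even (subst (λ k → 2 ∣ suc k)
        (inStep-at (subst (InStep k) y≡ st)) even′)

      top : ∀ {x y} → label x ≡ b ∸ ℓ → ¬ (x ⋖ y)
      top x≡ (up k odd st _) = odd (subst (λ k → 2 ∣ suc k)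
        (sym (inStep-at (subst (InStep k) (trans x≡ b∸ℓ) st))) even)
      top x≡ (down k even′ st x≡y) = ¬2∣consecutive (subst (2 ∣_)
        (inStep-before (ℕ.<⇒≤ (toℕ<n i)) st (trans (sym x≡y) (trans x≡ b∸ℓ))) even′) even

      position : ∀ {k} → a < k → k < b → ∃ λ j → suc j < ℓ × k ≡ b ∸ suc j
      position {k} a<k k<b =
        b ∸ suc k
        , ℕ.+-cancelˡ-< a _ _ (subst₂ _<_ (cong (a ℕ.+_) b∸k) (p-suc i)
            (subst (a ℕ.+ (b ∸ k) <_) (ℕ.m+[n∸m]≡n (ℕ.<⇒≤ k<b)) (ℕ.+-monoˡ-< (b ∸ k) a<k)))
        , trans (sym (ℕ.m∸[m∸n]≡n (ℕ.<⇒≤ k<b))) (cong (b ∸_) b∸k)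
        where
        b∸k : b ∸ k ≡ suc (b ∸ suc k)
        b∸k = ℕ.+-∸-assoc 1 k<b

    opaque
      chain : Chain i
      chain with 2 ∣? suc (toℕ i)
      ... | yes even = falling even
      ... | no  odd  = rising odd

  -- Local rules for rowmotion, read by label

  At : ℕ → Subset n → Set
  At k S = ∃ λ x → label x ≡ k × x ∈ S

  opaque
    at? : ∀ k S → Dec (At k S)
    at? k S = any? λ x → (label x ℕ.≟ k) ×-dec (x ∈? S)

  indicator≡at : ∀ x S → indicator x S ≡ ⟦ at? (label x) S ⟧
  indicator≡at x S = ⟦⟧-cong (x ∈? S) (at? (label x) S) (λ x∈ → x , refl , x∈)
    λ (y , y≡ , y∈) → subst (_∈ S) (label-injective y≡) y∈

  -- Reading membership by label gives the missing ends `0` and `p s` of the fence the count 0, so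
  -- the first and last segments obey the same laws as the others.
  at-0 : ∀ S → ⟦ at? 0 S ⟧ ≡ 0ℤ
  at-0 S = ⟦⟧-false (at? 0 S) λ ()

  at-p-s : ∀ S → ⟦ at? (p s) S ⟧ ≡ 0ℤ
  at-p-s S = ⟦⟧-false (at? (p s) S) λ (x , x≡ , _) → ℕ.<⇒≢ (label<p x) x≡

  -- An element labelled `p i` forces `i` to be neither `0` nor `s`; for these two indices both
  -- sides vanish.
  χₛ≡at : ∀ {i} → i ≤ s → ∀ A → χₛ i A ≡ ⟦ at? (p i) (Antichain.set A) ⟧
  χₛ≡at {i} i≤s A = ⟦⟧-cong (containsShared? i A) (at? (p i) (Antichain.set A))
    (λ (x , (_ , x≡) , x∈) → x , x≡ , x∈)
    λ (x , x≡ , x∈) → x , ((0<i x x≡ , ℕ.≤∧≢⇒< i≤s (i≢s x x≡)) , x≡) , x∈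
    where
    0<i : ∀ x → label x ≡ p i → 1 ≤ i
    0<i x x≡ = p-cancel-< (subst (0 <_) x≡ z<s)
    i≢s : ∀ x → label x ≡ p i → i ≢ s
    i≢s x x≡ refl = ℕ.<⇒≢ (label<p x) x≡

  ⋖-irrefl : ∀ {x} → ¬ (x ⋖ x)
  ⋖-irrefl (up _ _ _ eq)   = ℕ.1+n≢n (sym eq)
  ⋖-irrefl (down _ _ _ eq) = ℕ.1+n≢n (sym eq)

  module _ {A : Subset n} where

    generated-⋖ : ∀ {x y} → x ⋖ y → y ∈ generated A → x ∈ generated A
    generated-⋖ x⋖y = generated-isIdeal A (x⋖y ◅ ε)

    ⊆-generated : ∀ {x} → x ∈ A → x ∈ generated A
    ⊆-generated x∈A = ∈-comprehension⁺ (inGenerated? A) (_ , x∈A , ε)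

    generated-split : ∀ {x} → x ∈ generated A → x ∈ A ⊎ ∃ λ y → x ⋖ y × y ∈ generated A
    generated-split x∈ = split (∈-comprehension⁻ (inGenerated? A) x∈)
      where
      split : ∀ {x} → InGenerated A x → x ∈ A ⊎ ∃ λ y → x ⋖ y × y ∈ generated A
      split (_ , a∈ , ε)         = inj₁ a∈
      split (_ , a∈ , x⋖y ◅ y⊑a) =
        inj₂ (_ , x⋖y , ∈-comprehension⁺ (inGenerated? A) (_ , a∈ , y⊑a))

    -- Otherwise `y`, and with it `x`, would lie below some `a` in `A`; then `x = a`, and `x`, `y`
    -- would lie below each other.
    generated-above : IsAntichain A → ∀ {x y} → x ∈ A → x ⋖ y → y ∉ generated A
    generated-above anti {x} {y} x∈ x⋖y y∈ =
      let a , a∈ , y⊑a = ∈-comprehension⁻ (inGenerated? A) y∈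
          x≡a = anti x∈ a∈ (x⋖y ◅ y⊑a)
          x≡y = P.antisym (x⋖y ◅ ε) (subst (y ⊑_) (sym x≡a) y⊑a)
      in ⋖-irrefl (subst (x ⋖_) (sym x≡y) x⋖y)

  module _ {I : Subset n} (down : IsIdeal I) where

    minimals⁻ : ∀ {x} → x ∈ minimals (∁ I) → x ∉ I × (∀ {y} → y ⋖ x → y ∈ I)
    minimals⁻ {x} x∈ with ∈-comprehension⁻ (minimal? (∁ I)) x∈
    ... | x∈∁ , least = x∈∁p⇒x∉p x∈∁ , λ {y} y⋖x → decidable-stable (y ∈? I) λ y∉ →
      ⋖-irrefl (subst (_⋖ x) (least y (x∉p⇒x∈∁p y∉) (y⋖x ◅ ε)) y⋖x)

    -- Since `I` is an ideal, minimality in its complement can be tested on lower covers.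
    minimals⁺ : ∀ {x} → x ∉ I → (∀ {y} → y ⋖ x → y ∈ I) → x ∈ minimals (∁ I)
    minimals⁺ {x} x∉ lower = ∈-comprehension⁺ (minimal? (∁ I))
      (x∉p⇒x∈∁p x∉ , λ y y∈∁ y⊑x → least y⊑x (x∈∁p⇒x∉p y∈∁))
      where
      least : ∀ {y} → y ⊑ x → y ∉ I → y ≡ x
      least ε _ = refl
      -- `z` is outside `I` along with `y`, so `z = x` by induction; then `y` is a lower cover of
      -- `x` outside `I`.
      least (y⋖z ◅ z⊑x) y∉ with refl ← least z⊑x (λ z∈ → y∉ (down (y⋖z ◅ ε) z∈)) =
        contradiction (lower y⋖z) y∉

  module _ (A : Antichain) where
    private
      S = Antichain.set A
      g u a m : ℕ → ℤ
      a k = ⟦ at? k S ⟧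
      m k = ⟦ at? k (Antichain.set (ρ A)) ⟧
      g k = ⟦ at? k (generated S) ⟧
      u k = ⟦ at? k (∁ (generated S)) ⟧

    at-whole : ∀ {k} → (∃ λ x → label x ≡ k) → g k + u k ≡ 1ℤ
    at-whole {k} (x , x≡) = sym (trans (sym (⟦⟧-true present? (x , x≡)))
      (⟦⟧-⊎ present? (at? k (generated S)) (at? k (∁ (generated S)))
        split (λ (y , y≡ , _) → y , y≡) (λ (y , y≡ , _) → y , y≡) disjoint))
      where
      present? : Dec (∃ λ y → label y ≡ k)
      present? = any? λ y → label y ℕ.≟ k
      split : (∃ λ y → label y ≡ k) → At k (generated S) ⊎ At k (∁ (generated S))
      split (y , y≡) = Sum.map (λ y∈ → y , y≡ , y∈) (λ y∉ → y , y≡ , x∉p⇒x∈∁p y∉)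
                               (toSum (y ∈? generated S))
      disjoint : At k (generated S) → ¬ At k (∁ (generated S))
      disjoint (y , y≡ , y∈) (z , z≡ , z∈) = x∈∁p⇒x∉p z∈
        (subst (_∈ generated S) (label-injective (trans y≡ (sym z≡))) y∈)

    at-top : ∀ {k} → (∀ {x y} → label x ≡ k → ¬ (x ⋖ y)) → g k ≡ a k
    at-top {k} top = ⟦⟧-cong (at? k (generated S)) (at? k S) to
      λ (x , x≡ , x∈) → x , x≡ , ⊆-generated x∈
      where
      to : At k (generated S) → At k S
      to (x , x≡ , x∈) =
        [ (λ x∈S → x , x≡ , x∈S) , (λ (_ , x⋖y , _) → contradiction x⋖y (top x≡)) ]′
          (generated-split x∈)

    at-bottom : ∀ {k} → (∀ {x y} → label y ≡ k → ¬ (x ⋖ y)) → u k ≡ m k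
    at-bottom {k} bottom = ⟦⟧-cong (at? k (∁ (generated S))) (at? k (Antichain.set (ρ A)))
      (λ (x , x≡ , x∈) → x , x≡ ,
        minimals⁺ (generated-isIdeal S) (x∈∁p⇒x∉p x∈) λ y⋖x → contradiction y⋖x (bottom x≡))
      λ (x , x≡ , x∈) → x , x≡ , x∉p⇒x∈∁p (proj₁ (minimals⁻ (generated-isIdeal S) x∈))

    -- An element of the ideal is either a generator or below its only possible upper cover, the one
    -- labelled `k′`; the antichain condition excludes both at once. If `k′` labels no element, its
    -- term is 0.
    at-descend : ∀ {k k′} → (∀ {x y} → label x ≡ k → x ⋖ y → label y ≡ k′) →
                 (∀ {x y} → label x ≡ k → label y ≡ k′ → x ⋖ y) →
                 (∃ λ x → label x ≡ k) → g k ≡ a k + g k′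
    at-descend {k} {k′} upper cover (x₀ , x₀≡) =
      ⟦⟧-⊎ (at? k (generated S)) (at? k S) (at? k′ (generated S))
        split (λ (x , x≡ , x∈) → x , x≡ , ⊆-generated x∈)
        (λ (y , y≡ , y∈) → x₀ , x₀≡ , generated-⋖ (cover x₀≡ y≡) y∈)
        λ (x , x≡ , x∈) (y , y≡ , y∈) → generated-above (antichain A) x∈ (cover x≡ y≡) y∈
      where
      split : At k (generated S) → At k S ⊎ At k′ (generated S)
      split (x , x≡ , x∈) = Sum.map (λ x∈S → x , x≡ , x∈S)
        (λ (y , x⋖y , y∈) → y , upper x≡ x⋖y , y∈) (generated-split x∈)

    -- An element outside the ideal is either minimal there, hence in the next antichain `ρ A`, or
    -- has its only possible lower cover outside as well, and not both.
    at-ascend : ∀ {k k′} → (∀ {x y} → label y ≡ k → x ⋖ y → label x ≡ k′) →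
                (∀ {x y} → label x ≡ k′ → label y ≡ k → x ⋖ y) →
                (∃ λ x → label x ≡ k) → u k ≡ m k + u k′
    at-ascend {k} {k′} lower cover (x₀ , x₀≡) =
      ⟦⟧-⊎ (at? k (∁ (generated S))) (at? k (Antichain.set (ρ A))) (at? k′ (∁ (generated S)))
        split
        (λ (x , x≡ , x∈) → x , x≡ , x∉p⇒x∈∁p (proj₁ (minimals⁻ ideal′ x∈)))
        (λ (y , y≡ , y∈) → x₀ , x₀≡ , x∉p⇒x∈∁p λ x∈ →
          x∈∁p⇒x∉p y∈ (generated-⋖ (cover y≡ x₀≡) x∈))
        λ (x , x≡ , x∈) (y , y≡ , y∈) → x∈∁p⇒x∉p y∈ (proj₂ (minimals⁻ ideal′ x∈) (cover y≡ x≡))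
      where
      ideal′ = generated-isIdeal S
      split : At k (∁ (generated S)) → At k (Antichain.set (ρ A)) ⊎ At k′ (∁ (generated S))
      split (x , x≡ , x∈) = Sum.swap (Sum.map₂ (λ ¬y → x , x≡ ,
          minimals⁺ ideal′ (x∈∁p⇒x∉p x∈) λ {y} y⋖x → decidable-stable (y ∈? generated S) λ y∉ →
            ¬y (y , lower x≡ y⋖x , x∉p⇒x∈∁p y∉))
        (toSum (at? k′ (∁ (generated S)))))

-- Finite counts and induction over segments

count-initial : ∀ {A : Set} {P : Pred A 0ℓ} (P? : Decidable P) {m} (f : Fin m → A) {k} → k ≤ m →
                (∀ i → P (f i) → toℕ i < k) → (∀ i → toℕ i < k → P (f i)) →
                length (filter P? (List.tabulate f)) ≡ k
count-initial P? {ℕ.zero} f z≤n _ _ = refl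
count-initial P? {suc m} f {k} k≤ to from with P? (f zero)
count-initial P? {suc m} f {ℕ.zero} k≤ to from | yes p with () ← to zero p
count-initial P? {suc m} f {suc k} k≤ to from | yes p =
  cong suc (count-initial P? (f ∘ Fin.suc) (s≤s⁻¹ k≤)
    (λ i → s≤s⁻¹ ∘ to (Fin.suc i)) (λ i → from (Fin.suc i) ∘ s≤s))
count-initial P? {suc m} f {ℕ.zero} k≤ to from | no ¬p =
  count-initial P? (f ∘ Fin.suc) z≤n (λ i p → contradiction (to (Fin.suc i) p) λ ()) λ _ ()
count-initial P? {suc m} f {suc k} k≤ to from | no ¬p = contradiction (from zero z<s) ¬p

∑< : ℕ → (ℕ → ℤ) → ℤ
∑< ℕ.zero  T = 0ℤ
∑< (suc m) T = T 0 + ∑< m (T ∘ suc)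

∑<-last : ∀ m T → ∑< (suc m) T ≡ ∑< m T + T m
∑<-last ℕ.zero  T = ℤ.+-comm (T 0) 0ℤ
∑<-last (suc m) T =
  trans (cong (_+_ (T 0)) (∑<-last m (T ∘ suc))) (sym (ℤ.+-assoc (T 0) _ _))

∑-∑< : ∀ {X : Set} m (F : X → ℕ → ℤ) xs →
       ∑ (λ x → ∑< m (F x)) xs ≡ ∑< m (λ k → ∑ (λ x → F x k) xs)
∑-∑< ℕ.zero  F xs = ∑-0 xs
∑-∑< (suc m) F xs = trans (∑-+ (λ x → F x 0) _ xs)
  (cong (_+_ (∑ (λ x → F x 0) xs)) (∑-∑< m (λ x → F x ∘ suc) xs))

∣∣≡∑< : ∀ {m} (S : Subset m) T → (∀ x → ⟦ x ∈? S ⟧ ≡ T (toℕ x)) → + ∣ S ∣ ≡ ∑< m T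
∣∣≡∑< Vec.[]            T eq = refl
∣∣≡∑< (true Vec.∷ S)  T eq =
  cong₂ _+_ (eq zero) (∣∣≡∑< S (T ∘ suc) (eq ∘ Fin.suc))
∣∣≡∑< (false Vec.∷ S) T eq =
  trans (sym (ℤ.+-identityˡ _)) (cong₂ _+_ (eq zero) (∣∣≡∑< S (T ∘ suc) (eq ∘ Fin.suc)))

index : ∀ {s t} → t < s → ∃ λ (i : Fin s) → toℕ i ≡ t
index t<s = fromℕ< t<s , toℕ-fromℕ< t<s

segment-induction : ∀ {s} (Q : ℕ → Set) → Q 0 → (∀ (i : Fin s) → Q (toℕ i) → Q (suc (toℕ i))) →
                    ∀ {t} → t ≤ s → Q t
segment-induction Q base next {ℕ.zero} _   = base
segment-induction Q base next {suc t} t<s with i , refl ← index t<s =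
  next i (segment-induction Q base next (ℕ.<⇒≤ t<s))

-- Counts over an orbit

module FenceOrbits {s} (α : Vec ℕ s) (positive : ∀ i → 1 ≤ lookup α i) where

  open Fence α
  open FenceProperties α positive public

  -- An element at an end of the segment would also lie in the neighbouring segment; where there is
  -- no neighbour, the end label is `0` or `p s` and belongs to no element.
  unshared-inside : ∀ {i x} → Unshared i x → p (toℕ i) < label x × label x < p (suc (toℕ i))
  unshared-inside {i} {x} ((a≤ , ≤b) , only) =
    ℕ.≤∧≢⇒< a≤ (not-first (toℕ i) refl ∘ sym) , ℕ.≤∧≢⇒< ≤b not-last
    where
    not-first : ∀ t → toℕ i ≡ t → label x ≢ p (toℕ i)
    not-first ℕ.zero    eq x≡ = label≢0 {x} (trans x≡ (cong p eq))
    not-first (suc t) eq x≡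
      with j , refl ← index {s} {t} (ℕ.<-trans (ℕ.n<1+n t) (subst (_< s) eq (toℕ<n i))) =
      ℕ.1+n≢n (trans (sym eq) (cong toℕ (sym (only j
        ( ℕ.≤-trans (ℕ.<⇒≤ (p-step j)) (ℕ.≤-reflexive (trans (cong p (sym eq)) (sym x≡)))
        , ℕ.≤-reflexive (trans x≡ (cong p eq)))))))
    not-last : label x ≢ p (suc (toℕ i))
    not-last x≡ with ℕ.m≤n⇒m<n∨m≡n (toℕ<n i)
    ... | inj₂ 1+i≡s = ℕ.<⇒≢ (label<p x) (trans x≡ (cong p 1+i≡s))
    ... | inj₁ 1+i<s with j , j≡ ← index {s} 1+i<s =
      ℕ.1+n≢n (trans (sym j≡) (cong toℕ (only j
        ( ℕ.≤-reflexive (trans (cong p j≡) (sym x≡))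
        , ℕ.≤-trans (ℕ.≤-reflexive (trans x≡ (cong p (sym j≡)))) (ℕ.<⇒≤ (p-step j))))))

  -- The map `ψ` lets one argument serve both rowmotions: it is `id` for `ρ` and `φ` for `ρ̂`.
  module OrbitTotals
    {X : Set} {f : X → X} (f-injective : Injective _≡_ _≡_ f)
    (ψ : X → Antichain) (ψ-commutes : ∀ x → ψ (f x) ≡ ρ (ψ x)) (O : Orbit f)
    where

    N : ℤ
    N = + (# O)

    opaque
      T U G : ℕ → ℤ
      T k = total (λ x → ⟦ at? k (Antichain.set (ψ x)) ⟧) O
      U k = total (λ x → ⟦ at? k (∁ (generated (Antichain.set (ψ x)))) ⟧) O
      G k = total (λ x → ⟦ at? k (generated (Antichain.set (ψ x))) ⟧) O

      T-ρ : ∀ k → total (λ x → ⟦ at? k (Antichain.set (ρ (ψ x))) ⟧) O ≡ T k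
      T-ρ k = trans
        (∑-cong (λ x → cong (λ A → ⟦ at? k (Antichain.set A) ⟧) (sym (ψ-commutes x))) (elements O))
        (total-∘ f-injective O _)

      whole : ∀ {k} → (∃ λ x → label x ≡ k) → G k + U k ≡ N
      whole present = trans (sym (∑-+ _ _ (elements O)))
        (trans (∑-cong (λ x → at-whole (ψ x) present) (elements O)) (∑-1 (elements O)))

      top : ∀ {k} → (∀ {x y} → label x ≡ k → ¬ (x ⋖ y)) → G k ≡ T k
      top maximal = ∑-cong (λ x → at-top (ψ x) maximal) (elements O)

      bottom : ∀ {k} → (∀ {x y} → label y ≡ k → ¬ (x ⋖ y)) → U k ≡ T k
      bottom {k} minimal = trans (∑-cong (λ x → at-bottom (ψ x) minimal) (elements O)) (T-ρ k)

      progression : ∀ {i} (c : Chain i) → let open Chain c in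
                    IsProgression ℓ N (T ∘ lab) (U ∘ lab) (G ∘ lab)
      progression c = record
        { bottom  = bottom C.bottom
        ; top     = top C.top
        ; ascend  = λ {j} j< → trans
            (∑-cong (λ x → at-ascend (ψ x) (C.lower j<) (C.cover (ℕ.<-trans (ℕ.n<1+n j) j<))
                                     (C.present j<)) (elements O))
            (trans (∑-+ _ _ (elements O)) (cong (_+ U (C.lab j)) (T-ρ (C.lab (suc j)))))
        ; descend = λ j< → trans
            (∑-cong (λ x → at-descend (ψ x) (C.upper j<) (C.cover j<) (C.present j<)) (elements O))
            (∑-+ _ _ (elements O))
        ; whole   = whole ∘ C.present
        }
        where module C = Chain c

      T-0 : T 0 ≡ 0ℤ
      T-0 = trans (∑-cong (λ x → at-0 (Antichain.set (ψ x))) (elements O)) (∑-0 (elements O))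

      T-p-s : T (p s) ≡ 0ℤ
      T-p-s = trans (∑-cong (λ x → at-p-s (Antichain.set (ψ x))) (elements O)) (∑-0 (elements O))

      total-χ : total (χ ∘ ψ) O ≡ ∑< n (T ∘ suc)
      total-χ = trans
        (∑-cong (λ x → ∣∣≡∑< (Antichain.set (ψ x)) (λ k → ⟦ at? (suc k) (Antichain.set (ψ x)) ⟧)
                             (λ y → indicator≡at y (Antichain.set (ψ x)))) (elements O))
        (∑-∑< n (λ x k → ⟦ at? (suc k) (Antichain.set (ψ x)) ⟧) (elements O))

      total-χ[] : ∀ x → total (χ[ x ] ∘ ψ) O ≡ T (label x)
      total-χ[] x = ∑-cong (λ y → indicator≡at x (Antichain.set (ψ y))) (elements O)

      total-χₛ : ∀ {i} → i ≤ s → total (χₛ i ∘ ψ) O ≡ T (p i)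
      total-χₛ i≤s = ∑-cong (λ y → χₛ≡at i≤s (ψ y)) (elements O)

    segment-constant : ∀ i {k l} → p (toℕ i) < k → k < p (suc (toℕ i)) →
                       p (toℕ i) < l → l < p (suc (toℕ i)) → T k ≡ T l
    segment-constant i a<k k<b a<l l<b =
      let _ , j< , k≡ = Chain.position (chain i) a<k k<b
          _ , h< , l≡ = Chain.position (chain i) a<l l<b
      in trans (cong T k≡)
        (trans (IsProgression.constant (progression (chain i)) j< h<) (cong T (sym l≡)))

    segment-sum : ∀ i {k} → p (toℕ i) < k → k < p (suc (toℕ i)) →
                  + lookup α i * T k + (T (p (suc (toℕ i))) + T (p (toℕ i))) ≡ N
    segment-sum i {k} a<k k<b =
      let j , j< , k≡ = Chain.position (chain i) a<k k<b
      in trans (cong₂ (λ t u → + lookup α i * t + u) (cong T k≡) (sym (Chain.ends (chain i) T)))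
               (IsProgression.sum-law (progression (chain i)) j<)

    -- Modulo 2 the segment law says that the values of `T` at the two ends add up to `N`, so each
    -- segment adds `N`, starting from `T 0 = 0`.
    parity : (∀ i → 2 ∣ lookup α i) → ∀ {t} → t ≤ s → ∃ λ z → T (p t) ≡ N * + t + + 2 * z
    parity even = segment-induction (λ t → ∃ λ z → T (p t) ≡ N * + t + + 2 * z)
      (0ℤ , trans T-0 (zeros N)) λ i (z , eq) →
        let divides q ℓ≡ = even i in next (toℕ i) q z (T (suc (p (toℕ i)))) (lookup α i)
          ℓ≡ (segment-sum i ℕ.≤-refl (k<b i)) eq
      where
      open ≡-Reasoning
      zeros : ∀ a → 0ℤ ≡ a * 0ℤ + + 2 * 0ℤ
      zeros = solve-∀
      k<b : ∀ i → suc (p (toℕ i)) < p (suc (toℕ i))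
      -- A positive even part is at least 2, so `suc (p (toℕ i))` is interior.
      k<b i = subst (suc (p (toℕ i)) <_) (sym (p-suc i))
        (subst (_≤ p (toℕ i) ℕ.+ lookup α i) (ℕ.+-comm (p (toℕ i)) 2)
          (ℕ.+-monoʳ-≤ (p (toℕ i)) (∣⇒≤ {{ℕ.>-nonZero (positive i)}} (even i))))
      isolate : ∀ a u v → u ≡ a + (u + v) - a - v
      isolate = solve-∀
      collect : ∀ n t q r z → n - q * + 2 * r - (n * t + + 2 * z) ≡
                n * (1ℤ + t) + + 2 * (- (n * t) - z - q * r)
      collect = solve-∀
      next : ∀ t q z c ℓ {u v} → ℓ ≡ q ℕ.* 2 → + ℓ * c + (u + v) ≡ N → v ≡ N * + t + + 2 * z →
             ∃ λ z → u ≡ N * + suc t + + 2 * z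
      next t q z c ℓ {u} {v} ℓ≡ law v≡ = - (N * + t) - z - + q * c , (begin
        u                                                   ≡⟨ isolate (+ ℓ * c) u v ⟩
        + ℓ * c + (u + v) - + ℓ * c - v
          ≡⟨ cong₂ (λ n v → n - + ℓ * c - v) law v≡ ⟩
        N - + ℓ * c - (N * + t + + 2 * z)
          ≡⟨ cong (λ l → N - l * c - (N * + t + + 2 * z)) (trans (cong +_ ℓ≡) (ℤ.pos-* q 2)) ⟩
        N - + q * + 2 * c - (N * + t + + 2 * z)             ≡⟨ collect N (+ t) (+ q) c z ⟩
        N * + suc t + + 2 * (- (N * + t) - z - + q * c)     ∎)

    -- As `T (p s) = 0`, `parity` makes `N s` even. With `s + 1 = 2 q`, writing
    -- `N = N (s + 1) − N s` shows that `N` is even.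
    even-size : ¬ (2 ∣ s) → (∀ i → 2 ∣ lookup α i) → 2 ∣ # O
    even-size odd even =
      let z , eq       = parity even ℕ.≤-refl
          divides q s≡ = 2∣consecutive s odd
      in divides ℤ.∣ N * + q + z ∣
           (trans (cong ℤ.∣_∣ (N≡ q z s≡ (trans (sym T-p-s) eq))) (ℤ.abs-* (N * + q + z) (+ 2)))
      where
      open ≡-Reasoning
      isolate : ∀ n s z → n ≡ n * (1ℤ + s) - (n * s + + 2 * z) + + 2 * z
      isolate = solve-∀
      collect : ∀ n q z → n * (q * + 2) - 0ℤ + + 2 * z ≡ (n * q + z) * + 2
      collect = solve-∀
      N≡ : ∀ q z → suc s ≡ q ℕ.* 2 → 0ℤ ≡ N * + s + + 2 * z → N ≡ (N * + q + z) * + 2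
      N≡ q z s≡ eq = begin
        N                                             ≡⟨ isolate N (+ s) z ⟩
        N * + suc s - (N * + s + + 2 * z) + + 2 * z
          ≡⟨ cong₂ (λ a b → N * a - b + + 2 * z) (trans (cong +_ s≡) (ℤ.pos-* q 2)) (sym eq) ⟩
        N * (+ q * + 2) - 0ℤ + + 2 * z                ≡⟨ collect N (+ q) z ⟩
        (N * + q + z) * + 2                           ∎

    -- Doubling counts a shared element once for each of its two segments. In a partial sum the last
    -- end has been used by only one segment; its second copy is the term `T (p t)`, which the next
    -- segment law absorbs.
    zigzag-sum : (∀ i → lookup α i ≡ 2) → ∀ {t} → t ≤ s →
                 + 2 * ∑< (p t) (T ∘ suc) ≡ + t * N + T (p t)
    zigzag-sum two = segment-induction (λ t → + 2 * ∑< (p t) (T ∘ suc) ≡ + t * N + T (p t))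
      (sym (cong (_+_ 0ℤ) T-0))
      λ i → next (toℕ i) (p (toℕ i)) (p≡ i)
              (subst₂ (λ l b → + l * T (suc (p (toℕ i))) + (T b + T (p (toℕ i))) ≡ N) (two i) (p≡ i)
                (segment-sum i ℕ.≤-refl (ℕ.≤-reflexive (sym (p≡ i)))))
      where
      open ≡-Reasoning
      p≡ : ∀ i → p (suc (toℕ i)) ≡ suc (suc (p (toℕ i)))
      p≡ i = trans (p-suc i) (trans (cong (p (toℕ i) ℕ.+_) (two i)) (ℕ.+-comm (p (toℕ i)) 2))
      expand : ∀ a b c → + 2 * (a + b + c) ≡ + 2 * a + + 2 * (b + c)
      expand = solve-∀
      regroup : ∀ a b c d → a + b + + 2 * (c + d) ≡ a + (+ 2 * c + (d + b)) + d
      regroup = solve-∀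
      increment : ∀ t n → t * n + n ≡ (1ℤ + t) * n
      increment = solve-∀
      next : ∀ t k {b} → b ≡ suc (suc k) → + 2 * T (suc k) + (T (suc (suc k)) + T k) ≡ N →
             + 2 * ∑< k (T ∘ suc) ≡ + t * N + T k → + 2 * ∑< b (T ∘ suc) ≡ + suc t * N + T b
      next t k refl law eq = begin
        + 2 * ∑< (suc (suc k)) (T ∘ suc)
          ≡⟨ cong (_*_ (+ 2)) (trans (∑<-last (suc k) (T ∘ suc))
               (cong (_+ T (suc (suc k))) (∑<-last k (T ∘ suc)))) ⟩
        + 2 * (∑< k (T ∘ suc) + T (suc k) + T (suc (suc k)))
          ≡⟨ expand (∑< k (T ∘ suc)) (T (suc k)) (T (suc (suc k))) ⟩
        + 2 * ∑< k (T ∘ suc) + + 2 * (T (suc k) + T (suc (suc k)))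
          ≡⟨ cong (_+ + 2 * (T (suc k) + T (suc (suc k)))) eq ⟩
        + t * N + T k + + 2 * (T (suc k) + T (suc (suc k)))
          ≡⟨ regroup (+ t * N) (T k) (T (suc k)) (T (suc (suc k))) ⟩
        + t * N + (+ 2 * T (suc k) + (T (suc (suc k)) + T k)) + T (suc (suc k))
          ≡⟨ cong (λ u → + t * N + u + T (suc (suc k))) law ⟩
        + t * N + N + T (suc (suc k))
          ≡⟨ cong (_+ T (suc (suc k))) (increment (+ t) N) ⟩
        + suc t * N + T (suc (suc k)) ∎

  -- From ideals to antichains

  antichain-orbit : Orbit ρ̂ → Orbit ρ
  antichain-orbit = image-orbit ρ̂-injective ρ-injective φ φ-injective λ _ → refl

  module _ (O : Orbit ρ̂) where
    open OrbitTotals ρ̂-injective φ (λ _ → refl) O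

    opaque
      unfolding OrbitTotals.G
      -- `ρ̂ I` is the ideal generated by `φ I`, so shifting the orbit by one step turns ideals into
      -- generated ideals.
      total-χ̂ : ∀ x → total χ̂[ x ] O ≡ G (label x)
      total-χ̂ x = trans (sym (total-∘ ρ̂-injective O χ̂[ x ]))
        (∑-cong (λ I → indicator≡at x (generated (Antichain.set (φ I)))) (elements O))

    r≡total : ∀ {i} → i ≤ s → + r i (antichain-orbit O) ≡ T (p i)
    r≡total {i} i≤s = trans (sym (∑-⟦⟧ (containsShared? i) (List.map φ (elements O))))
      (trans (∑-map φ (χₛ i) (elements O)) (total-χₛ i≤s))

    -- A maximal element is in an ideal only as a generator.
    total-χ̂-maximal : ∀ {i x} → OddSegment i → label x ≡ p (suc (toℕ i)) →
                      total χ̂[ x ] O ≡ T (p (suc (toℕ i)))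
    total-χ̂-maximal {i} {x} odd x≡ = trans (total-χ̂ x) (trans (cong G x≡)
      (top λ {y} y≡ → Chain.top (rising i odd) {y} (trans y≡ (p-suc i))))

    -- A minimal element outside an ideal is minimal in the complement, hence in the next antichain.
    total-χ̂-minimal : ∀ {i x} → OddSegment i → label x ≡ p (toℕ i) →
                      total χ̂[ x ] O + T (p (toℕ i)) ≡ + (# O)
    total-χ̂-minimal {i} {x} odd x≡ = trans
      (cong₂ _+_ (trans (total-χ̂ x) (cong G x≡))
        (sym (bottom λ {y} {z} z≡ →
          Chain.bottom (rising i odd) {y} {z} (trans z≡ (sym (ℕ.+-identityʳ _))))))
      (whole (x , x≡))

-- Homomesies for antichains

module FenceHomomesies {m} (α : Vec ℕ (suc m)) (positive : ∀ i → 1 ≤ lookup α i) where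

  open Fence α
  open FenceOrbits α positive public

  module _ (O : Orbit ρ) where
    open OrbitTotals ρ-injective id (λ _ → refl) O

    unshared-average : ∀ i x y → Unshared i x → Unshared i y →
      average (λ A → χ[ x ] A - χ[ y ] A) O ≡ 0ℚ
    unshared-average i x y ux uy = average-≡ _ O 0ℤ 1 (begin
      + 1 * total (λ A → χ[ x ] A - χ[ y ] A) O
        ≡⟨ cong (_*_ (+ 1)) (trans (∑-+ χ[ x ] (λ A → - χ[ y ] A) (elements O))
             (cong₂ _+_ (total-χ[] x)
               (trans (∑-neg χ[ y ] (elements O))
                 (cong -_ (trans (total-χ[] y) (sym Tx≡Ty)))))) ⟩
      + 1 * (T (label x) - T (label x))
        ≡⟨ cancel (T (label x)) N ⟩
      0ℤ * N ∎)
      where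
      open ≡-Reasoning
      Tx≡Ty : T (label x) ≡ T (label y)
      Tx≡Ty = let a<x , x<b = unshared-inside ux
                  a<y , y<b = unshared-inside uy
              in segment-constant i a<x x<b a<y y<b
      cancel : ∀ a n → + 1 * (a - a) ≡ 0ℤ * n
      cancel = solve-∀

    segment-average : ∀ i x → Unshared i x →
      average (λ A → + lookup α i * χ[ x ] A + χₛ (suc (toℕ i)) A + χₛ (toℕ i) A) O ≡ 1ℚ
    segment-average i x ux = average-≡ _ O 1ℤ 1 (cong (_*_ 1ℤ) (begin
      total (λ A → + lookup α i * χ[ x ] A + χₛ (suc (toℕ i)) A + χₛ (toℕ i) A) O
        ≡⟨ trans (∑-+ (λ A → + lookup α i * χ[ x ] A + χₛ (suc (toℕ i)) A) (χₛ (toℕ i)) (elements O))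
             (cong₂ _+_ (trans (∑-+ (λ A → + lookup α i * χ[ x ] A) (χₛ (suc (toℕ i))) (elements O))
               (cong₂ _+_ (trans (∑-* (+ lookup α i) χ[ x ] (elements O))
                   (cong (_*_ (+ lookup α i)) (total-χ[] x)))
                 (total-χₛ (toℕ<n i))))
               (total-χₛ (ℕ.<⇒≤ (toℕ<n i)))) ⟩
      + lookup α i * T (label x) + T (p (suc (toℕ i))) + T (p (toℕ i))
        ≡⟨ ℤ.+-assoc (+ lookup α i * T (label x)) _ _ ⟩
      + lookup α i * T (label x) + (T (p (suc (toℕ i))) + T (p (toℕ i)))
        ≡⟨ (let a<x , x<b = unshared-inside ux
            in segment-sum i a<x x<b) ⟩
      N ∎))
      where open ≡-Reasoning

    zigzag-average : (∀ i → lookup α i ≡ 2) → average χ O ≡ + suc m / 2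
    zigzag-average two = average-≡ χ O (+ suc m) 2 (begin
      + 2 * total χ O                        ≡⟨ cong (_*_ (+ 2)) total-χ ⟩
      + 2 * ∑< n (T ∘ suc)
        ≡⟨ cong (_*_ (+ 2)) (drop-last (p (suc m)) (p-strict z<s ℕ.≤-refl) T-p-s) ⟩
      + 2 * ∑< (p (suc m)) (T ∘ suc)              ≡⟨ zigzag-sum two ℕ.≤-refl ⟩
      + suc m * N + T (p (suc m))               ≡⟨ cong (_+_ (+ suc m * N)) T-p-s ⟩
      + suc m * N + 0ℤ                     ≡⟨ ℤ.+-identityʳ _ ⟩
      + suc m * N                          ∎)
      where
      open ≡-Reasoning
      -- The elements stop at `n = p s ∸ 1`, whereas `zigzag-sum` runs up to `p s`, whose term is 0.
      drop-last : ∀ q → 0 < q → T q ≡ 0ℤ → ∑< (q ∸ 1) (T ∘ suc) ≡ ∑< q (T ∘ suc)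
      drop-last (suc q) _ eq = sym (trans (∑<-last q (T ∘ suc))
        (trans (cong (_+_ (∑< q (T ∘ suc))) eq) (ℤ.+-identityʳ _)))

  -- Ranks in the first segment

  odd-zero : OddSegment zero
  odd-zero 2∣1 with () ← ∣1⇒≡1 2∣1

  -- Below the first peak a path down from `x` stays in the first segment, and each cover lowers the
  -- label by one.
  first-segment-⊑ : ∀ {x y} → y ⊑ x → label x < p 1 → label y ≤ label x
  first-segment-⊑ ε _ = ℕ.≤-refl
  first-segment-⊑ {x} {y} (y⋖z ◅ z⊑x) x<p =
    let z≤x = first-segment-⊑ z⊑x x<p
        j , j< , z≡ = Chain.position (rising zero odd-zero) z<s (ℕ.≤-<-trans z≤x x<p)
    in ℕ.≤-trans (ℕ.≤-reflexive (Chain.lower (rising zero odd-zero) j< z≡ y⋖z))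
         (ℕ.≤-trans (ℕ.n≤1+n j) (subst (_≤ label x) z≡ z≤x))

  ⊑-first-segment : ∀ d {x y} → label y ℕ.+ d ≡ label x → label x < p 1 → y ⊑ x
  ⊑-first-segment ℕ.zero {x} {y} eq _ =
    subst (_⊑ x) (label-injective (trans (sym eq) (ℕ.+-identityʳ _))) ε
  ⊑-first-segment (suc d) {x} {y} eq x<p =
    let y<x = ℕ.<-≤-trans (ℕ.m<m+n (label y) {suc d} z<s) (ℕ.≤-reflexive eq)
        z , z≡ = element {suc (label y)} z<s (ℕ.≤-<-trans y<x (label<p x))
        y<p = ℕ.<-trans y<x x<p
    in Chain.cover (rising zero odd-zero) (subst (label y <_) (p-suc zero) y<p) refl z≡
       ◅ ⊑-first-segment d (trans (cong (ℕ._+ d) z≡) (trans (sym (ℕ.+-suc (label y) d)) eq)) x<p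

  first-segment-unshared : ∀ {x} → label x < p 1 → Unshared zero x
  first-segment-unshared {x} x<p = (z≤n , ℕ.<⇒≤ x<p) , only
    where
    only : ∀ j → InSegment j x → j ≡ zero
    only zero        _        = refl
    only (Fin.suc j) (p≤ , _) = contradiction (ℕ.≤-trans (p-mono (s≤s z≤n)) p≤) (ℕ.<⇒≱ x<p)

  -- The unshared elements weakly below `x` are exactly those labelled from 1 to `label x`.
  first-segment-rank : ∀ {j x} → IsUnshared zero j x → j ≡ label x
  first-segment-rank {j} {x} (ux , count) = trans (sym count)
    (count-initial (λ y → unshared? zero y ×-dec (y ⊑? x)) id (toℕ<n x)
      -- By definition `toℕ y < label x` is the same as `label y ≤ label x`.
      (λ y (_ , y⊑x) → first-segment-⊑ y⊑x x<p)
      λ y y<x → first-segment-unshared (ℕ.≤-<-trans y<x x<p) ,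
                 ⊑-first-segment (label x ∸ label y) (ℕ.m+[n∸m]≡n y<x) x<p)
    where x<p = proj₂ (unshared-inside ux)

  -- Homomesies for ideals

  module _ (O : Orbit ρ̂) where
    open OrbitTotals ρ̂-injective φ (λ _ → refl) O

    -- On the first segment `T 0 = 0`, so the progression `U` is proportional to the label.
    first-segment-total : ∀ {x} → Unshared zero x → total χ̂[ x ] O + + label x * T (label x) ≡ N
    first-segment-total {x} ux =
      let a<x , x<b   = unshared-inside ux
          c           = rising zero odd-zero
          j , j< , x≡ = Chain.position c a<x x<b
          U≡ = trans (IsProgression.linear (progression c) j<)
                 (cong (_+ + suc j * T (suc j)) T-0)
      in trans (cong₂ _+_ (total-χ̂ O x)
           (trans (cong (λ k → + k * T k) x≡)
             (trans (sym (ℤ.+-identityˡ _))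
               (trans (sym U≡) (cong U (sym x≡))))))
           (whole (x , refl))

    -- The two totals are `N − j t` and `N − k t` with a common `t`, which the combination
    -- eliminates.
    first-segment-average : ∀ j k x y → IsUnshared zero j x → IsUnshared zero k y →
      average (λ I → + k * χ̂[ x ] I - + j * χ̂[ y ] I) O ≡ (+ k - + j) / 1
    first-segment-average j k x y ux uy = average-≡ _ O (+ k - + j) 1 (begin
      + 1 * total (λ I → + k * χ̂[ x ] I - + j * χ̂[ y ] I) O
        ≡⟨ cong (_*_ (+ 1)) (trans
             (∑-+ (λ I → + k * χ̂[ x ] I) (λ I → - (+ j * χ̂[ y ] I)) (elements O))
             (cong₂ _+_ (∑-* (+ k) χ̂[ x ] (elements O))
               (trans (∑-neg (λ I → + j * χ̂[ y ] I) (elements O))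
                      (cong -_ (∑-* (+ j) χ̂[ y ] (elements O)))))) ⟩
      + 1 * (+ k * total χ̂[ x ] O - + j * total χ̂[ y ] O)
        ≡⟨ expand (+ j) (+ k) (total χ̂[ x ] O) (total χ̂[ y ] O) t ⟩
      + k * (total χ̂[ x ] O + + j * t) - + j * (total χ̂[ y ] O + + k * t)
        ≡⟨ cong₂ (λ u v → + k * u - + j * v) x-law y-law ⟩
      + k * N - + j * N
        ≡⟨ collect (+ k) (+ j) N ⟩
      (+ k - + j) * N ∎)
      where
      open ≡-Reasoning
      t = T (label x)
      x-law : total χ̂[ x ] O + + j * t ≡ N
      x-law = trans (cong (λ l → total χ̂[ x ] O + + l * t) (first-segment-rank ux))
                    (first-segment-total (proj₁ ux))
      y-law : total χ̂[ y ] O + + k * t ≡ N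
      y-law = trans (cong₂ (λ l u → total χ̂[ y ] O + + l * u) (first-segment-rank uy)
        (let a<x , x<b = unshared-inside (proj₁ ux)
             a<y , y<b = unshared-inside (proj₁ uy)
         in segment-constant zero a<x x<b a<y y<b))
        (first-segment-total (proj₁ uy))
      expand : ∀ j k a b t → + 1 * (k * a - j * b) ≡ k * (a + j * t) - j * (b + k * t)
      expand = solve-∀
      collect : ∀ a b n → a * n - b * n ≡ (a - b) * n
      collect = solve-∀

    shared-average : ∀ i j x y → IsShared (suc (2 ℕ.* i)) x → IsShared (2 ℕ.* j) y →
      (∀ O → r (suc (2 ℕ.* i)) O ≡ r (2 ℕ.* j) O) → average (λ I → χ̂[ x ] I + χ̂[ y ] I) O ≡ 1ℚ
    shared-average i j x y ((_ , i<s) , x≡) ((_ , j<s) , y≡) r≡ =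
      average-≡ _ O 1ℤ 1 (cong (_*_ 1ℤ) (begin
        total (λ I → χ̂[ x ] I + χ̂[ y ] I) O          ≡⟨ ∑-+ χ̂[ x ] χ̂[ y ] (elements O) ⟩
        total χ̂[ x ] O + total χ̂[ y ] O              ≡⟨ ℤ.+-comm (total χ̂[ x ] O) _ ⟩
        total χ̂[ y ] O + total χ̂[ x ] O
          ≡⟨ cong (_+_ (total χ̂[ y ] O)) (trans x-total T≡) ⟩
        total χ̂[ y ] O + T (p (2 ℕ.* j))             ≡⟨ y-total ⟩
        N                                             ∎))
      where
      open ≡-Reasoning
      odd : ∀ k → ¬ (2 ∣ suc (2 ℕ.* k))
      odd k = ¬2∣consecutive (m∣m*n k)
      -- Counting from 0, `x` is the top of segment `2 i` and `y` is the bottom of segment `2 j`;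
      -- both are odd segments in the count from 1.
      a : ∃ λ (k : Fin (suc m)) → toℕ k ≡ 2 ℕ.* i
      a = index (ℕ.<-trans (ℕ.n<1+n _) i<s)
      b : ∃ λ (k : Fin (suc m)) → toℕ k ≡ 2 ℕ.* j
      b = index j<s
      T≡ : T (p (suc (2 ℕ.* i))) ≡ T (p (2 ℕ.* j))
      T≡ = trans (sym (r≡total O (ℕ.<⇒≤ i<s)))
        (trans (cong +_ (r≡ (antichain-orbit O))) (r≡total O (ℕ.<⇒≤ j<s)))
      x-total : total χ̂[ x ] O ≡ T (p (suc (2 ℕ.* i)))
      x-total = trans
        (total-χ̂-maximal O {proj₁ a} {x} (subst (λ k → ¬ (2 ∣ suc k)) (sym (proj₂ a)) (odd i))
          (trans x≡ (cong (p ∘ suc) (sym (proj₂ a)))))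
        (cong (T ∘ p ∘ suc) (proj₂ a))
      y-total : total χ̂[ y ] O + T (p (2 ℕ.* j)) ≡ N
      y-total = subst (λ k → total χ̂[ y ] O + T (p k) ≡ N) (proj₂ b)
        (total-χ̂-minimal O {proj₁ b} {y} (subst (λ k → ¬ (2 ∣ suc k)) (sym (proj₂ b)) (odd j))
          (trans y≡ (cong p (sym (proj₂ b)))))

  shared-mesic : ∀ i j x y → IsShared (2 ℕ.* i ∸ 1) x → IsShared (2 ℕ.* j) y →
    (∀ O → r (2 ℕ.* i ∸ 1) O ≡ r (2 ℕ.* j) O) → Mesic ρ̂ (λ I → χ̂[ x ] I + χ̂[ y ] I) 1ℚ
  -- Truncated subtraction gives `2 * 0 ∸ 1 = 0`, and no element is `s_0`.
  shared-mesic ℕ.zero  j x y ((() , _) , _)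
  shared-mesic (suc i) j x y sx sy r≡ O = shared-average O i j x y
    (subst (λ k → IsShared k x) 2i≡ sx) sy (subst (λ k → ∀ O → r k O ≡ r (2 ℕ.* j) O) 2i≡ r≡)
    where
    2i≡ : 2 ℕ.* suc i ∸ 1 ≡ suc (2 ℕ.* i)
    2i≡ = ℕ.+-suc i (i ℕ.+ 0)

theorem3p1 : ∀ {m} (let s = suc m) (α : Vec ℕ s) →
    (∀ i → 1 ≤ lookup α i) → 2 ≤ head α → 2 ≤ last α →
    let open Fence α in
    (∀ i x y → Unshared i x → Unshared i y →
    Mesic ρ (λ A → χ[ x ] A - χ[ y ] A) 0ℚ)
    × (∀ i x → Unshared i x →
    Mesic ρ (λ A → + lookup α i * χ[ x ] A + χₛ (suc (toℕ i)) A + χₛ (toℕ i) A) 1ℚ)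
    × (∀ j k x y → IsUnshared zero j x → IsUnshared zero k y →
    Mesic ρ̂ (λ I → + k * χ̂[ x ] I - + j * χ̂[ y ] I) ((+ k - + j) / 1))
    × (∀ i j x y → IsShared (2 ℕ.* i ∸ 1) x → IsShared (2 ℕ.* j) y →
    (∀ O → r (2 ℕ.* i ∸ 1) O ≡ r (2 ℕ.* j) O) →
    Mesic ρ̂ (λ I → χ̂[ x ] I + χ̂[ y ] I) 1ℚ)
    × (¬ (2 ∣ s) → (∀ i → 2 ∣ lookup α i) →
    (∀ (O : Orbit ρ) → 2 ∣ # O) × (∀ (O : Orbit ρ̂) → 2 ∣ # O))
    × ((∀ i → lookup α i ≡ 2) → Mesic ρ χ (+ s / 2))
theorem3p1 α positive _ _ =
    (λ i x y ux uy O → unshared-average O i x y ux uy)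
  , (λ i x ux O → segment-average O i x ux)
  , (λ j k x y ux uy O → first-segment-average O j k x y ux uy)
  , shared-mesic
  , (λ odd even → (λ O → OrbitTotals.even-size ρ-injective id (λ _ → refl) O odd even)
                , (λ O → OrbitTotals.even-size ρ̂-injective φ (λ _ → refl) O odd even))
  , (λ two O → zigzag-average O two)
  where
  open Fence α
  open FenceHomomesies α positive
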